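{- Let $p<q<r$ be odd primes. Let $\rho$ and $\sigma$ be the unique non-negative integers such that $(p-1)(q-1)=\rho p+\sigma q$, and put $\tau=(p-1)(q+r-1)$. If $qr>\tau$, then $$h(\Psi_{pqr}(x))\le\max\{\min(\rho+1,\sigma+1),\ \min(q-1-\rho,\ p-1-\sigma)\}.$$
   Context: $\Phi_n(x)$ is the $n$-th cyclotomic polynomial and $\Psi_n(x)=(x^n-1)/\Phi_n(x)\in\mathbb Z[x]$. The height $h(f)$ of $f\in\mathbb Z[x]$ is the maximum absolute value of its coefficients. -}

module Defs where

open import Data.Nat as ℕ using (ℕ; zero; suc; _⊔_; _<ᵇ_)
open import Data.Nat.Divisibility using (_∣?_)
open import Data.Integer as ℤ using (ℤ; +_; -[1+_]; ∣_∣)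
open import Data.List using (List; []; _∷_; _++_; [_]; reverse; length; map; replicate; foldr)
open import Data.Product using (_×_; _,_)
open import Data.Bool using (if_then_else_)
open import Relation.Nullary using (does)

-- Polynomials over ℤ as coefficient lists, lowest degree first:
-- a₀ ∷ a₁ ∷ … represents a₀ + a₁ x + ….
Poly : Set
Poly = List ℤ

padd : Poly → Poly → Poly
padd [] g = g
padd f [] = f
padd (a ∷ f) (b ∷ g) = (a ℤ.+ b) ∷ padd f g

pmul : Poly → Poly → Poly
pmul [] g = []
pmul (a ∷ f) g = padd (map (a ℤ.*_) g) (+ 0 ∷ pmul f g)

xnm1 : ℕ → Poly
xnm1 zero = []
xnm1 (suc k) = -[1+ 0 ] ∷ (replicate k (+ 0) ++ [ + 1 ])

-- Drop leading zeros of a highest-degree-first list.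
dropZeros : List ℤ → List ℤ
dropZeros [] = []
dropZeros (+ 0 ∷ r) = dropZeros r
dropZeros (c ∷ r) = c ∷ r

-- r ↦ r - c·g on the first entries (highest-degree-first).
subPrefix : ℤ → List ℤ → List ℤ → List ℤ
subPrefix c [] r = r
subPrefix c (b ∷ g) [] = []
subPrefix c (b ∷ g) (x ∷ r) = (x ℤ.- c ℤ.* b) ∷ subPrefix c g r

-- Long division (highest-degree-first) by a monic divisor 1·x^m + gt,
-- where gt is the list of the m lower coefficients; returns the quotient
-- (highest-degree-first). Fuel argument bounds the number of steps.
divH : ℕ → List ℤ → List ℤ → List ℤ
divH zero r gt = []
divH (suc k) [] gt = []
divH (suc k) (c ∷ r) gt =
  if length r <ᵇ length gt then [] else c ∷ divH k (subPrefix c gt r) gt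

tailL : List ℤ → List ℤ
tailL [] = []
tailL (_ ∷ l) = l

-- Quotient of f by a monic polynomial g (polynomial long division).
pdiv : Poly → Poly → Poly
pdiv f g = reverse (divH (length f) (dropZeros (reverse f)) (tailL (dropZeros (reverse g))))

prodDivs : ℕ → List (ℕ × Poly) → Poly
prodDivs n = foldr (λ { (d , φ) acc → if does (d ∣? n) then pmul φ acc else acc }) [ + 1 ]

-- Table [(1,Φ₁),…,(k,Φ_k)], using the standard recursive definition
-- Φ_n = (x^n - 1) / ∏_{d ∣ n, d < n} Φ_d.
phis : ℕ → List (ℕ × Poly)
phis zero = []
phis (suc k) = phis k ++ [ (suc k , pdiv (xnm1 (suc k)) (prodDivs (suc k) (phis k))) ]

lastPoly : List (ℕ × Poly) → Poly
lastPoly [] = [ + 1 ]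
lastPoly ((_ , φ) ∷ []) = φ
lastPoly (_ ∷ l@(_ ∷ _)) = lastPoly l

-- The n-th cyclotomic polynomial (n ≥ 1).
Φ : ℕ → Poly
Φ n = lastPoly (phis n)

Ψ : ℕ → Poly
Ψ n = pdiv (xnm1 n) (Φ n)

height : Poly → ℕ
height = foldr (λ a m → ∣ a ∣ ⊔ m) 0

-- In ℤ[[x]] every xⁿ − 1 with n ≥ 1 is a unit, so the relations between the Φ_d become identities
-- between products of such units, and only the existence of Φ_pq and Φ_pqr as polynomials has
-- to be argued.  They give Ψ_pqr = (x^qr − 1) · T with T = Φ_pq · (1 + xʳ + … + x^(p−1)r), and
-- deg T = τ < qr makes h(Ψ_pqr) = h(T).  Lam and Leung's formula writes T = A − x B, where A is
-- a product of three geometric sums in x^p, x^q, xʳ with ρ+1, σ+1 and p terms.  The product of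
-- two geometric sums in x^m, xⁿ with m, n coprime and few enough terms has coefficients 0 and 1,
-- so the coefficients of A lie between 0 and min(ρ+1, σ+1); those of B lie between 0 and
-- min(q−1−ρ, p−1−σ) in the same way, and |A − x B| is at most the maximum of both.
module Submission where

open import Defs

-- Every xⁿ - 1 being a unit in ℤ[[x]], divisibility there says nothing, whereas long division by a
-- monic polynomial is known to return a given series only if that series is a polynomial and the
-- division is exact. So each quotient must be shown to have finite support. This includes Φ_pqr,
-- which is absent from the formula for Ψ_pqr but is the divisor in its definition. The hard case is
-- that Φ_pq(x) divides Φ_pq(xʳ), with quotient Φ_pqr. An argument with roots of unity would leave
-- ℤ[[x]]. Instead, Φ_pq(x) = (x^pq - 1) / ((x^q - 1)(1 + x + ... + x^(p-1))), so it suffices that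
-- x^pq - 1 divides Φ_pq(xʳ)(x^q - 1)(1 + x + ... + x^(p-1)) with a polynomial cofactor. With rs ≡ 1
-- modulo pq, the last two factors may be evaluated at x^(rs) instead of x, and the product then
-- splits into x^pq - 1, geometric sums and one further quotient like Φ_pq, belonging to p and s.
-- This is why the existence statement is proved for coprime exponents and not only for primes.

-- The commutative ring of formal power series over ℤ

module PowerSeries where

  open import Algebra.Bundles using (CommutativeRing)
  open import Data.Integer using (ℤ; +_; _+_; _*_; -_)
  import Data.Integer.Properties as ℤ
  open import Data.Integer.Tactic.RingSolver using (solve-∀)
  open import Data.Nat using (ℕ; zero; suc)
  open import Data.Product using (_,_)
  open import Function using (_∘_)
  open import Level using (0ℓ)
  open import Relation.Binary.PropositionalEquality
  open ≡-Reasoning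

  Series : Set
  Series = ℕ → ℤ

  infix 4 _≈_
  record _≈_ (f g : Series) : Set where
    constructor pointwise
    field at : ∀ n → f n ≡ g n
  open _≈_ public

  infixl 6 _⊕_
  infixl 7 _⊛_

  _⊕_ : Series → Series → Series
  (f ⊕ g) n = f n + g n

  ⊖_ : Series → Series
  (⊖ f) n = - f n

  _⊛_ : Series → Series → Series
  (f ⊛ g) zero    = f 0 * g 0
  (f ⊛ g) (suc n) = f 0 * g (suc n) + (f ∘ suc ⊛ g) n

  const : ℤ → Series
  const c zero    = c
  const c (suc n) = + 0

  ⊛-cong : ∀ {f f′ g g′} → f ≈ f′ → g ≈ g′ → f ⊛ g ≈ f′ ⊛ g′
  ⊛-cong f≈ g≈ = pointwise λ n → go (at f≈) (at g≈) n
    where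
    go : ∀ {f f′ g g′} → (∀ n → f n ≡ f′ n) → (∀ n → g n ≡ g′ n) →
         ∀ n → (f ⊛ g) n ≡ (f′ ⊛ g′) n
    go f≡ g≡ zero    = cong₂ _*_ (f≡ 0) (g≡ 0)
    go f≡ g≡ (suc n) = cong₂ _+_ (cong₂ _*_ (f≡ 0) (g≡ (suc n))) (go (f≡ ∘ suc) g≡ n)

  -- The definition of `⊛` strips the constant term of the left factor; this mirror image strips the
  -- right one, and commutativity follows by playing the two against each other.
  ⊛-sucʳ : ∀ f g n → (f ⊛ g) (suc n) ≡ f (suc n) * g 0 + (f ⊛ (g ∘ suc)) n
  ⊛-sucʳ f g zero    = ℤ.+-comm (f 0 * g 1) (f 1 * g 0)
  ⊛-sucʳ f g (suc n) = begin
    f 0 * g (suc (suc n)) + (f ∘ suc ⊛ g) (suc n)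
      ≡⟨ cong (_+_ (f 0 * g (suc (suc n)))) (⊛-sucʳ (f ∘ suc) g n) ⟩
    f 0 * g (suc (suc n)) + (f (suc (suc n)) * g 0 + (f ∘ suc ⊛ g ∘ suc) n)
      ≡⟨ lemma (f 0 * g (suc (suc n))) (f (suc (suc n)) * g 0) _ ⟩
    f (suc (suc n)) * g 0 + (f 0 * g (suc (suc n)) + (f ∘ suc ⊛ g ∘ suc) n) ∎
    where
    lemma : ∀ a b c → a + (b + c) ≡ b + (a + c)
    lemma = solve-∀

  ⊛-comm : ∀ f g n → (f ⊛ g) n ≡ (g ⊛ f) n
  ⊛-comm f g zero    = ℤ.*-comm (f 0) (g 0)
  ⊛-comm f g (suc n) = begin
    f 0 * g (suc n) + (f ∘ suc ⊛ g) n ≡⟨ cong₂ _+_ (ℤ.*-comm (f 0) _) (⊛-comm (f ∘ suc) g n) ⟩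
    g (suc n) * f 0 + (g ⊛ f ∘ suc) n ≡⟨ ⊛-sucʳ g f n ⟨
    (g ⊛ f) (suc n)                   ∎

  ⊛-distribʳ : ∀ h f g n → ((f ⊕ g) ⊛ h) n ≡ (f ⊛ h) n + (g ⊛ h) n
  ⊛-distribʳ h f g zero    = ℤ.*-distribʳ-+ (h 0) (f 0) (g 0)
  ⊛-distribʳ h f g (suc n) = begin
    (f 0 + g 0) * h (suc n) + ((f ∘ suc ⊕ g ∘ suc) ⊛ h) n
      ≡⟨ cong (_+_ ((f 0 + g 0) * h (suc n))) (⊛-distribʳ h (f ∘ suc) (g ∘ suc) n) ⟩
    (f 0 + g 0) * h (suc n) + ((f ∘ suc ⊛ h) n + (g ∘ suc ⊛ h) n)
      ≡⟨ lemma (f 0) (g 0) (h (suc n)) _ _ ⟩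
    f 0 * h (suc n) + (f ∘ suc ⊛ h) n + (g 0 * h (suc n) + (g ∘ suc ⊛ h) n) ∎
    where
    lemma : ∀ a b c u v → (a + b) * c + (u + v) ≡ a * c + u + (b * c + v)
    lemma = solve-∀

  ⊛-scaleˡ : ∀ c f g n → ((λ i → c * f i) ⊛ g) n ≡ c * (f ⊛ g) n
  ⊛-scaleˡ c f g zero    = ℤ.*-assoc c (f 0) (g 0)
  ⊛-scaleˡ c f g (suc n) = begin
    c * f 0 * g (suc n) + ((λ i → c * f (suc i)) ⊛ g) n
      ≡⟨ cong (_+_ (c * f 0 * g (suc n))) (⊛-scaleˡ c (f ∘ suc) g n) ⟩
    c * f 0 * g (suc n) + c * (f ∘ suc ⊛ g) n
      ≡⟨ lemma c (f 0) (g (suc n)) _ ⟩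
    c * (f 0 * g (suc n) + (f ∘ suc ⊛ g) n) ∎
    where
    lemma : ∀ c a b u → c * a * b + c * u ≡ c * (a * b + u)
    lemma = solve-∀

  -- The tail of `f ⊛ g` is by definition a multiple of the tail of `g` plus the product of the tail
  -- of `f` with `g`, so distributivity and scaling on the left carry the induction.
  ⊛-assoc : ∀ f g h n → ((f ⊛ g) ⊛ h) n ≡ (f ⊛ (g ⊛ h)) n
  ⊛-assoc f g h zero    = ℤ.*-assoc (f 0) (g 0) (h 0)
  ⊛-assoc f g h (suc n) = begin
    f 0 * g 0 * h (suc n) + (((λ i → f 0 * g (suc i)) ⊕ (f ∘ suc ⊛ g)) ⊛ h) n
      ≡⟨ cong (_+_ (f 0 * g 0 * h (suc n))) (⊛-distribʳ h (λ i → f 0 * g (suc i)) (f ∘ suc ⊛ g) n) ⟩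
    f 0 * g 0 * h (suc n) + (((λ i → f 0 * g (suc i)) ⊛ h) n + ((f ∘ suc ⊛ g) ⊛ h) n)
      ≡⟨ cong (_+_ (f 0 * g 0 * h (suc n)))
           (cong₂ _+_ (⊛-scaleˡ (f 0) (g ∘ suc) h n) (⊛-assoc (f ∘ suc) g h n)) ⟩
    f 0 * g 0 * h (suc n) + (f 0 * (g ∘ suc ⊛ h) n + (f ∘ suc ⊛ (g ⊛ h)) n)
      ≡⟨ lemma (f 0) (g 0) (h (suc n)) _ _ ⟩
    f 0 * (g 0 * h (suc n) + (g ∘ suc ⊛ h) n) + (f ∘ suc ⊛ (g ⊛ h)) n ∎
    where
    lemma : ∀ a b c u v → a * b * c + (a * u + v) ≡ a * (b * c + u) + v
    lemma = solve-∀

  0⊛ : ∀ f n → ((λ _ → + 0) ⊛ f) n ≡ + 0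
  0⊛ f zero    = ℤ.*-zeroˡ (f 0)
  0⊛ f (suc n) = cong₂ _+_ (ℤ.*-zeroˡ (f (suc n))) (0⊛ f n)

  const-⊛ : ∀ c f n → (const c ⊛ f) n ≡ c * f n
  const-⊛ c f zero    = refl
  const-⊛ c f (suc n) = trans (cong (_+_ (c * f (suc n))) (0⊛ f n)) (ℤ.+-identityʳ _)

  ⊛-identityˡ : ∀ f n → (const (+ 1) ⊛ f) n ≡ f n
  ⊛-identityˡ f n = trans (const-⊛ (+ 1) f n) (ℤ.*-identityˡ (f n))

  seriesRing : CommutativeRing 0ℓ 0ℓ
  seriesRing = record
    { Carrier = Series
    ; _≈_ = _≈_
    ; _+_ = _⊕_
    ; _*_ = _⊛_
    ; -_ = ⊖_
    ; 0# = const (+ 0)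
    ; 1# = const (+ 1)
    ; isCommutativeRing = record
      { isRing = record
        { +-isAbelianGroup = record
          { isGroup = record
            { isMonoid = record
              { isSemigroup = record
                { isMagma = record
                  { isEquivalence = record
                    { refl = pointwise λ _ → refl
                    ; sym = λ e → pointwise λ n → sym (at e n)
                    ; trans = λ e e′ → pointwise λ n → trans (at e n) (at e′ n) }
                  ; ∙-cong = λ e e′ → pointwise λ n → cong₂ _+_ (at e n) (at e′ n) }
                ; assoc = λ f g h → pointwise λ n → ℤ.+-assoc (f n) (g n) (h n) }
              ; identity = (λ f → pointwise λ n → trans (cong (_+ f n) (0at n)) (ℤ.+-identityˡ (f n)))
                         , (λ f → pointwise λ n → trans (cong (_+_ (f n)) (0at n)) (ℤ.+-identityʳ (f n))) }
            ; inverse = (λ f → pointwise λ n → trans (ℤ.+-inverseˡ (f n)) (sym (0at n)))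
                      , (λ f → pointwise λ n → trans (ℤ.+-inverseʳ (f n)) (sym (0at n)))
            ; ⁻¹-cong = λ e → pointwise λ n → cong -_ (at e n) }
          ; comm = λ f g → pointwise λ n → ℤ.+-comm (f n) (g n) }
        ; *-cong = ⊛-cong
        ; *-assoc = λ f g h → pointwise (⊛-assoc f g h)
        ; *-identity = (λ f → pointwise (⊛-identityˡ f))
                     , (λ f → pointwise λ n → trans (⊛-comm f _ n) (⊛-identityˡ f n))
        ; distrib = (λ f g h → pointwise λ n → trans (⊛-comm f (g ⊕ h) n)
                       (trans (⊛-distribʳ f g h n) (cong₂ _+_ (⊛-comm g f n) (⊛-comm h f n))))
                  , (λ f g h → pointwise (⊛-distribʳ f g h)) }
      ; *-comm = λ f g → pointwise (⊛-comm f g) } }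
    where
    0at : ∀ n → const (+ 0) n ≡ + 0
    0at zero    = refl
    0at (suc n) = refl

-- An abstract ring of series with a predicate for polynomials

open import Algebra.Bundles using (CommutativeRing)
open import Algebra.Solver.Ring.AlmostCommutativeRing
  using (fromCommutativeRing; _-Raw-AlmostCommutative⟶_)
open import Data.Integer.Base using () renaming (+-*-rawRing to ℤ-rawRing)
open import Data.Nat as ℕ using (ℕ; zero; suc; NonZero)
open import Data.Product as Product using (∃; _×_; _,_; proj₁; proj₂)
open import Level using (0ℓ)

-- P singles out the polynomials among the power series X n = xⁿ.
record SeriesRing : Set₁ where
  field
    A : CommutativeRing 0ℓ 0ℓ
  open CommutativeRing A
  field
    ι      : ℤ-rawRing -Raw-AlmostCommutative⟶ fromCommutativeRing A
    X      : ℕ → Carrier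
    X-0    : X 0 ≈ 1#
    X-+    : ∀ a b → X (a ℕ.+ b) ≈ X a * X b
    E-unit : ∀ n .{{_ : NonZero n}} → ∃ λ u → u * (X n - 1#) ≈ 1#
    P      : Carrier → Set
    P-resp : ∀ {f g} → f ≈ g → P f → P g
    P-X    : ∀ n → P (X n)
    P-+    : ∀ {f g} → P f → P g → P (f + g)
    P-neg  : ∀ {f} → P f → P (- f)
    P-*    : ∀ {f g} → P f → P g → P (f * g)
    P-X*   : ∀ n {f} → P (X n * f) → P f

-- Geometric sums, existence of cyclotomic polynomials, Lam and Leung's formula

module Geometric (R : SeriesRing) where

  open SeriesRing R
  open CommutativeRing A
  import Data.Integer as ℤ
  open import Data.Maybe as Maybe using (Maybe)
  open import Data.Nat.Coprimality using (Coprime; coprime-Bézout)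
  open import Data.Nat.Divisibility using (_∣_; ∣m+n∣m⇒∣n; ∣1⇒≡1; ∣n⇒∣m*n; ∣m⇒∣m*n; ∣m∣n⇒∣m+n; ∣-refl; _∣0)
  open import Data.Nat.GCD using (module Bézout)
  import Data.Nat.Properties as ℕ
  open import Data.Nat.Solver using (module +-*-Solver)
  open import Relation.Binary.PropositionalEquality as ≡ using (_≡_; _≢_; cong)
  open import Relation.Nullary.Decidable using (dec⇒maybe)
  open import Relation.Binary.Reasoning.Setoid setoid
  open import Algebra.Properties.Ring ring using (-‿distribʳ-*)
  open _-Raw-AlmostCommutative⟶_ ι using (⟦_⟧)
  module N = +-*-Solver

  _coeff≟_ : ∀ a b → Maybe (⟦ a ⟧ ≈ ⟦ b ⟧)
  a coeff≟ b = Maybe.map (λ { ≡.refl → refl }) (dec⇒maybe (a ℤ.≟ b))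

  open import Algebra.Solver.Ring ℤ-rawRing (fromCommutativeRing A) ι _coeff≟_
    using (solve; _:=_; _:+_; _:*_; _:-_)

  X-≡ : ∀ {m n} → m ≡ n → X m ≈ X n
  X-≡ eq = reflexive (cong X eq)

  E : ℕ → Carrier
  E n = X n - 1#

  E-≡ : ∀ {m n} → m ≡ n → E m ≈ E n
  E-≡ eq = reflexive (cong E eq)

  *-E : ∀ u a → u * E a ≈ X a * u - u
  *-E u a = trans (distribˡ u _ _)
    (+-cong (*-comm u _) (trans (sym (-‿distribʳ-* u 1#)) (-‿cong (*-identityʳ u))))

  -- The geometric sum with `k` terms in x^a; for a prime p, `S p 1` is Φ_p(x) and `S p r` is
  -- Φ_p(xʳ).
  S : ℕ → ℕ → Carrier
  S zero    a = 0#
  S (suc k) a = S k a + X (k ℕ.* a)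

  P-1 : P 1#
  P-1 = P-resp X-0 (P-X 0)

  P-E : ∀ n → P (E n)
  P-E n = P-+ (P-X n) (P-neg P-1)

  P-S : ∀ k a → P (S k a)
  P-S zero    a = P-resp (-‿inverseʳ 1#) (P-+ P-1 (P-neg P-1))
  P-S (suc k) a = P-+ (P-S k a) (P-X (k ℕ.* a))

  S-E : ∀ k a → S k a * E a ≈ E (k ℕ.* a)
  S-E zero    a = trans (zeroˡ _) (sym (trans (+-congʳ X-0) (-‿inverseʳ 1#)))
  S-E (suc k) a = begin
    (S k a + X (k ℕ.* a)) * (X a - 1#)
      ≈⟨ distribʳ _ _ _ ⟩
    S k a * E a + X (k ℕ.* a) * (X a - 1#)
      ≈⟨ +-cong (S-E k a) (*-E _ a) ⟩
    X (k ℕ.* a) - 1# + (X a * X (k ℕ.* a) - X (k ℕ.* a))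
      ≈⟨ solve 3 (λ u v o → u :- o :+ (v :* u :- u) := v :* u :- o) refl _ (X a) _ ⟩
    X a * X (k ℕ.* a) - 1#
      ≈⟨ +-congʳ (X-+ a (k ℕ.* a)) ⟨
    X (a ℕ.+ k ℕ.* a) - 1# ∎

  Regular : Carrier → Set
  Regular f = ∀ {g h} → f * g ≈ f * h → g ≈ h

  E-regular : ∀ n .{{_ : NonZero n}} → Regular (E n)
  E-regular n {{n≢0}} {g} {h} eq = begin
    g             ≈⟨ *-identityˡ g ⟨
    1# * g        ≈⟨ *-congʳ uE ⟨
    u * E n * g   ≈⟨ *-assoc _ _ _ ⟩
    u * (E n * g) ≈⟨ *-congˡ eq ⟩
    u * (E n * h) ≈⟨ *-assoc _ _ _ ⟨
    u * E n * h   ≈⟨ *-congʳ uE ⟩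
    1# * h        ≈⟨ *-identityˡ h ⟩
    h             ∎
    where
    u = proj₁ (E-unit n)
    uE = proj₂ (E-unit n)

  regular-* : ∀ {f g} → Regular f → Regular g → Regular (f * g)
  regular-* rf rg eq = rg (rf (trans (sym (*-assoc _ _ _)) (trans eq (*-assoc _ _ _))))

  -- Makes `S p 1` cancellable as a factor of x^p - 1, without an inverse for it.
  regular-factorˡ : ∀ {f g h} → f * g ≈ h → Regular h → Regular f
  regular-factorˡ {f} {g} {h} fg≈h rh {u} {v} eq = rh (begin
    h * u       ≈⟨ *-congʳ fg≈h ⟨
    f * g * u   ≈⟨ comm′ f g u ⟩
    g * (f * u) ≈⟨ *-congˡ eq ⟩
    g * (f * v) ≈⟨ comm′ f g v ⟨
    f * g * v   ≈⟨ *-congʳ fg≈h ⟩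
    h * v       ∎)
    where
    comm′ : ∀ f g u → f * g * u ≈ g * (f * u)
    comm′ = solve 3 (λ f g u → f :* g :* u := g :* (f :* u)) refl

  -- For distinct primes m and n this characterises Φ_mn(x^c), written without division. Later the
  -- exponents are also used with numbers that are merely coprime.
  IsΦ : ℕ → ℕ → ℕ → Carrier → Set
  IsΦ c m n W = E (c ℕ.* m) * E (c ℕ.* n) * W ≈ E (c ℕ.* (m ℕ.* n)) * E c

  -- From 1 + y n = x m, x^(c y n) (x^c − 1) = E (c x m) − E (c y n), so x^(c y n) W is
  -- visibly a polynomial.
  module _ (c m n x y : ℕ) .{{_ : NonZero c}} .{{_ : NonZero m}} .{{_ : NonZero n}}
           (eq : 1 ℕ.+ y ℕ.* n ≡ x ℕ.* m) where
    private
      instance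
        _ = ℕ.m*n≢0 c m
        _ = ℕ.m*n≢0 c n
      k = c ℕ.* (y ℕ.* n)
      Em = E (c ℕ.* m)
      En = E (c ℕ.* n)
      Emn = E (c ℕ.* (m ℕ.* n))
      um = proj₁ (E-unit (c ℕ.* m))
      un = proj₁ (E-unit (c ℕ.* n))
      W = um * un * (Emn * E c)
      V = S x (c ℕ.* m) * S m (c ℕ.* n) - S y (c ℕ.* n) * S n (c ℕ.* m)

      P-V : P V
      P-V = P-+ (P-* (P-S x _) (P-S m _)) (P-neg (P-* (P-S y _) (P-S n _)))

      W-eq : Em * En * W ≈ Emn * E c
      W-eq = begin
        Em * En * W
          ≈⟨ rearrange Em En um un (Emn * E c) ⟩
        (um * Em) * (un * En) * (Emn * E c)
          ≈⟨ *-congʳ (*-cong (proj₂ (E-unit (c ℕ.* m))) (proj₂ (E-unit (c ℕ.* n)))) ⟩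
        1# * 1# * (Emn * E c)
          ≈⟨ trans (*-congʳ (*-identityˡ 1#)) (*-identityˡ _) ⟩
        Emn * E c ∎
        where
        rearrange : ∀ a b u v w → a * b * (u * v * w) ≈ (u * a) * (v * b) * w
        rearrange = solve 5 (λ a b u v w → a :* b :* (u :* v :* w) := (u :* a) :* (v :* b) :* w) refl

      swap : ∀ c y n → c ℕ.* (y ℕ.* n) ≡ y ℕ.* (c ℕ.* n)
      swap = N.solve 3 (λ c y n → c N.:* (y N.:* n) N.:= y N.:* (c N.:* n)) ≡.refl

      XE : X k * E c ≈ E (x ℕ.* (c ℕ.* m)) - E (y ℕ.* (c ℕ.* n))
      XE = begin
        X k * E c
          ≈⟨ *-E (X k) c ⟩
        X c * X k - X k
          ≈⟨ insert (X c * X k) (X k) 1# ⟩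
        (X c * X k - 1#) - E k
          ≈⟨ +-cong (+-congʳ (sym (X-+ c k))) (-‿cong (E-≡ (swap c y n))) ⟩
        E (c ℕ.+ k) - E (y ℕ.* (c ℕ.* n))
          ≈⟨ +-congʳ (E-≡ index) ⟩
        E (x ℕ.* (c ℕ.* m)) - E (y ℕ.* (c ℕ.* n)) ∎
        where
        insert : ∀ u v o → u - v ≈ (u - o) - (v - o)
        insert = solve 3 (λ u v o → u :- v := (u :- o) :- (v :- o)) refl
        index : c ℕ.+ k ≡ x ℕ.* (c ℕ.* m)
        index = ≡.trans (≡.sym (ℕ.*-suc c (y ℕ.* n))) (≡.trans (cong (c ℕ.*_) eq) (swap c x m))

      XW≈V : X k * W ≈ V
      XW≈V = regular-* (E-regular (c ℕ.* m)) (E-regular (c ℕ.* n)) (begin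
        Em * En * (X k * W)
          ≈⟨ rearrange (Em * En) (X k) W ⟩
        X k * (Em * En * W)
          ≈⟨ *-congˡ W-eq ⟩
        X k * (Emn * E c)
          ≈⟨ rearrange′ (X k) Emn (E c) ⟩
        X k * E c * Emn
          ≈⟨ *-congʳ XE ⟩
        (E (x ℕ.* (c ℕ.* m)) - E (y ℕ.* (c ℕ.* n))) * Emn
          ≈⟨ distrib-- _ _ Emn ⟩
        E (x ℕ.* (c ℕ.* m)) * Emn - E (y ℕ.* (c ℕ.* n)) * Emn
          ≈⟨ +-cong
               (*-cong (sym (S-E x _)) (trans (E-≡ (swap c m n)) (sym (S-E m _))))
               (-‿cong (*-cong (sym (S-E y _))
                 (trans (E-≡ (≡.trans (cong (c ℕ.*_) (ℕ.*-comm m n)) (swap c n m))) (sym (S-E n _))))) ⟩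
        S x (c ℕ.* m) * Em * (S m (c ℕ.* n) * En) - S y (c ℕ.* n) * En * (S n (c ℕ.* m) * Em)
          ≈⟨ collect (S x _) (S m _) (S y _) (S n _) Em En ⟩
        Em * En * V ∎)
        where
        rearrange : ∀ a u w → a * (u * w) ≈ u * (a * w)
        rearrange = solve 3 (λ a u w → a :* (u :* w) := u :* (a :* w)) refl
        rearrange′ : ∀ u a b → u * (a * b) ≈ u * b * a
        rearrange′ = solve 3 (λ u a b → u :* (a :* b) := (u :* b) :* a) refl
        distrib-- : ∀ a b e → (a - b) * e ≈ a * e - b * e
        distrib-- = solve 3 (λ a b e → (a :- b) :* e := a :* e :- b :* e) refl
        collect : ∀ s t u v a b →
          s * a * (t * b) - u * b * (v * a) ≈ a * b * (s * t - u * v)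
        collect = solve 6 (λ s t u v a b → s :* a :* (t :* b) :- u :* b :* (v :* a)
                                         := a :* b :* (s :* t :- u :* v)) refl

    Φ-exists-Bézout : ∃ λ W → P W × IsΦ c m n W
    Φ-exists-Bézout = W , P-X* k (P-resp (sym XW≈V) P-V) , W-eq

  -- Bézout's identity comes with either sign; since `IsΦ` is symmetric in `m` and `n`, the second
  -- sign is the first one with the roles exchanged.
  Φ-exists : ∀ c m n .{{_ : NonZero c}} .{{_ : NonZero m}} .{{_ : NonZero n}} →
             Coprime m n → ∃ λ W → P W × IsΦ c m n W
  Φ-exists c m n m⊥n = go (coprime-Bézout m⊥n)
    where
    swap : ∀ {W} → IsΦ c n m W → IsΦ c m n W
    swap {W} W-eq = begin
      E (c ℕ.* m) * E (c ℕ.* n) * W ≈⟨ *-congʳ (*-comm _ _) ⟩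
      E (c ℕ.* n) * E (c ℕ.* m) * W ≈⟨ W-eq ⟩
      E (c ℕ.* (n ℕ.* m)) * E c     ≈⟨ *-congʳ (E-≡ (cong (c ℕ.*_) (ℕ.*-comm n m))) ⟩
      E (c ℕ.* (m ℕ.* n)) * E c     ∎
    go : Bézout.Identity 1 m n → ∃ λ W → P W × IsΦ c m n W
    go (Bézout.+- x y eq) = Φ-exists-Bézout c m n x y eq
    go (Bézout.-+ x y eq) = Product.map₂ (Product.map₂ swap) (Φ-exists-Bézout c n m y x eq)

  infix 4 _≡_[mod_]
  -- The condition `P z` carries all the content: `E n` is a unit for n ≥ 1, so without it any two
  -- series would be congruent.
  _≡_[mod_] : Carrier → Carrier → ℕ → Set
  f ≡ g [mod n ] = ∃ λ z → P z × f ≈ g + E n * z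

  module _ (N t j k : ℕ) (eq : 1 ℕ.+ k ℕ.* N ≡ t ℕ.+ j ℕ.* N) where
    -- The module hypothesis is t ≡ 1 modulo `N` without subtraction. Its `i`-fold multiple makes
    -- x^(ikN) · x^i and x^(ijN) · x^(it) the same power, and each x^(multiple of N) differs from 1
    -- by a geometric sum times `E N`.
    X-shift : ∀ i → X i ≡ X (i ℕ.* t) [mod N ]
    X-shift i = X (i ℕ.* t) * S (i ℕ.* j) N - X i * S (i ℕ.* k) N
              , P-+ (P-* (P-X _) (P-S (i ℕ.* j) N)) (P-neg (P-* (P-X i) (P-S (i ℕ.* k) N)))
              , (begin
      X i
        ≈⟨ complete (X i) (X (i ℕ.* k ℕ.* N)) ⟩
      X (i ℕ.* k ℕ.* N) * X i - (X (i ℕ.* k ℕ.* N) * X i - X i)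
        ≈⟨ +-cong shifted (-‿cong (sym (*-E (X i) _))) ⟩
      X (i ℕ.* j ℕ.* N) * X (i ℕ.* t) - X i * E (i ℕ.* k ℕ.* N)
        ≈⟨ +-congʳ (complete′ _ (X (i ℕ.* t))) ⟩
      X (i ℕ.* t) + (X (i ℕ.* j ℕ.* N) * X (i ℕ.* t) - X (i ℕ.* t)) - X i * E (i ℕ.* k ℕ.* N)
        ≈⟨ +-cong (+-congˡ (trans (sym (*-E _ _)) (*-congˡ (sym (S-E (i ℕ.* j) N)))))
                  (-‿cong (*-congˡ (sym (S-E (i ℕ.* k) N)))) ⟩
      X (i ℕ.* t) + X (i ℕ.* t) * (S (i ℕ.* j) N * E N) - X i * (S (i ℕ.* k) N * E N)
        ≈⟨ collect (X (i ℕ.* t)) (X i) (S (i ℕ.* j) N) (S (i ℕ.* k) N) (E N) ⟩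
      X (i ℕ.* t) + E N * (X (i ℕ.* t) * S (i ℕ.* j) N - X i * S (i ℕ.* k) N) ∎)
      where
      complete : ∀ u v → u ≈ v * u - (v * u - u)
      complete = solve 2 (λ u v → u := v :* u :- (v :* u :- u)) refl
      complete′ : ∀ v u → v * u ≈ u + (v * u - u)
      complete′ = solve 2 (λ v u → v :* u := u :+ (v :* u :- u)) refl
      collect : ∀ u v a b e → u + u * (a * e) - v * (b * e) ≈ u + e * (u * a - v * b)
      collect = solve 5 (λ u v a b e → u :+ u :* (a :* e) :- v :* (b :* e)
                                     := u :+ e :* (u :* a :- v :* b)) refl
      index : i ℕ.* k ℕ.* N ℕ.+ i ≡ i ℕ.* j ℕ.* N ℕ.+ i ℕ.* t
      index = ≡.trans (N.solve 3 (λ i k n → i N.:* k N.:* n N.:+ i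
                                          N.:= i N.:* (N.con 1 N.:+ k N.:* n)) ≡.refl i k N)
             (≡.trans (cong (i ℕ.*_) eq)
               (N.solve 4 (λ i j n t → i N.:* (t N.:+ j N.:* n)
                                N.:= i N.:* j N.:* n N.:+ i N.:* t) ≡.refl i j N t))
      shifted : X (i ℕ.* k ℕ.* N) * X i ≈ X (i ℕ.* j ℕ.* N) * X (i ℕ.* t)
      shifted = trans (sym (X-+ _ i)) (trans (X-≡ index) (X-+ _ _))

    E-shift : ∀ i → E i ≡ E (i ℕ.* t) [mod N ]
    E-shift i = let z , Pz , eq = X-shift i in z , Pz , trans (+-congʳ eq) (rearrange _ _ _)
      where
      rearrange : ∀ a b c → a + b - c ≈ a - c + b
      rearrange = solve 3 (λ a b c → a :+ b :- c := a :- c :+ b) refl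

    S-shift : ∀ m → S m 1 ≡ S m t [mod N ]
    S-shift zero    = 0# , P-S 0 0 , sym (trans (+-identityˡ _) (zeroʳ _))
    S-shift (suc m) =
      let z , Pz , eqz = S-shift m
          y , Py , eqy = X-shift m
      in z + y , P-+ Pz Py , (begin
      S m 1 + X (m ℕ.* 1)               ≈⟨ +-cong eqz (trans (X-≡ (ℕ.*-identityʳ m)) eqy) ⟩
      S m t + E N * z + (X (m ℕ.* t) + E N * y) ≈⟨ rearrange _ _ _ _ _ ⟩
      S m t + X (m ℕ.* t) + E N * (z + y) ∎)
      where
      rearrange : ∀ a b e z y → a + e * z + (b + e * y) ≈ a + b + e * (z + y)
      rearrange = solve 5 (λ a b e z y → a :+ e :* z :+ (b :+ e :* y) := a :+ b :+ e :* (z :+ y)) refl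

  inverse-mod : ∀ r N → Coprime r N → ∃ λ s → ∃ λ j → ∃ λ k → 1 ℕ.+ k ℕ.* N ≡ r ℕ.* s ℕ.+ j ℕ.* N
  inverse-mod r N r⊥N with coprime-Bézout r⊥N
  ... | Bézout.+- x y eq = x , 0 , y , ≡.trans eq (≡.trans (ℕ.*-comm x r) (≡.sym (ℕ.+-identityʳ _)))
  inverse-mod r zero r⊥N | Bézout.-+ x y eq with ≡.trans eq (ℕ.*-zeroʳ y)
  ... | ()
  -- Here x r ≡ -1 modulo N = M + 1, and M ≡ -1 as well, so x M is an inverse of r.
  inverse-mod r (suc M) r⊥N | Bézout.-+ x y eq = x ℕ.* M , 1 , y ℕ.* M ,
    ≡.trans (N.solve 2 (λ y m → N.con 1 N.:+ y N.:* m N.:* (N.con 1 N.:+ m)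
                        N.:= N.con 1 N.:+ y N.:* (N.con 1 N.:+ m) N.:* m) ≡.refl y M)
    (≡.trans (cong (λ u → 1 ℕ.+ u ℕ.* M) (≡.sym eq))
    (N.solve 3 (λ x r m → N.con 1 N.:+ (N.con 1 N.:+ x N.:* r) N.:* m
                        N.:= r N.:* (x N.:* m) N.:+ N.con 1 N.:* (N.con 1 N.:+ m)) ≡.refl x r M))

  module _ (p q r : ℕ) .{{_ : NonZero p}} .{{_ : NonZero q}} .{{_ : NonZero r}}
           (p≢1 : p ≢ 1) (p⊥q : Coprime p q) (r⊥pq : Coprime r (p ℕ.* q)) where
    private
      N = p ℕ.* q
      inv = inverse-mod r N r⊥pq
      s = proj₁ inv
      t = r ℕ.* s
      j = proj₁ (proj₂ inv)
      k = proj₁ (proj₂ (proj₂ inv))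
      eq : 1 ℕ.+ k ℕ.* N ≡ t ℕ.+ j ℕ.* N
      eq = proj₂ (proj₂ (proj₂ inv))

      -- A common divisor of p and s divides both rs + jpq = 1 + kpq and kpq. Coprimality is what
      -- makes the quotient `V` for p and s available.
      p⊥s : Coprime p s
      p⊥s {d} (d∣p , d∣s) = ∣1⇒≡1 (∣m+n∣m⇒∣n
        (≡.subst (d ∣_) (≡.trans (≡.sym eq) (ℕ.+-comm 1 _))
          (∣m∣n⇒∣m+n (∣n⇒∣m*n r d∣s) (∣n⇒∣m*n j (∣m⇒∣m*n q d∣p))))
        (∣n⇒∣m*n k (∣m⇒∣m*n q d∣p)))

      instance
        s≢0 : NonZero s
        s≢0 = ℕ.≢-nonZero λ s≡0 → p≢1 (p⊥s (∣-refl , ≡.subst (p ∣_) (≡.sym s≡0) (p ∣0)))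
        _ = ℕ.m*n≢0 r p
        _ = ℕ.m*n≢0 r q
        _ = ℕ.m*n≢0 r s

      -- For distinct primes `Y` is Φ_pq(xʳ) = Φ_pq(x) Φ_pqr(x). `V` is the same quotient with s in
      -- place of q, and `H` below will turn out to be Φ_pqr.
      Y V Ep Eq z₁ z₂ St Et S₁ : Carrier
      Y = proj₁ (Φ-exists r p q p⊥q)
      V = proj₁ (Φ-exists r p s p⊥s)
      Y-eq : IsΦ r p q Y
      Y-eq = proj₂ (proj₂ (Φ-exists r p q p⊥q))
      V-eq : IsΦ r p s V
      V-eq = proj₂ (proj₂ (Φ-exists r p s p⊥s))
      Ep = E p
      Eq = E q
      S₁ = S p 1
      St = S p t
      Et = E (q ℕ.* t)
      z₁ = proj₁ (S-shift N t j k eq p)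
      z₂ = proj₁ (E-shift N t j k eq q)

      H₀ = S r N * S s (r ℕ.* q) * V
      H = H₀ + Y * (z₂ * S₁ + Et * z₁)

      P-H : P H
      P-H = P-+ (P-* (P-* (P-S r N) (P-S s _)) (proj₁ (proj₂ (Φ-exists r p s p⊥s))))
        (P-* (proj₁ (proj₂ (Φ-exists r p q p⊥q)))
          (P-+ (P-* (proj₁ (proj₂ (E-shift N t j k eq q))) (P-S p 1))
               (P-* (P-E _) (proj₁ (proj₂ (S-shift N t j k eq p))))))

      -- Written as a fraction, the left side regroups into E(rN)/E(N), which is `S r N`;
      -- E(qt)/E(rq), which is `S s (r q)`; the quotient E(rps) E(r) / (E(rp) E(rs)), which is `V`;
      -- and a remaining factor `E N`.
      YEtSt : Y * Et * St ≈ E N * H₀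
      YEtSt = regular-* (E-regular (r ℕ.* p)) (E-regular (r ℕ.* s)) (begin
        E (r ℕ.* p) * E (r ℕ.* s) * (Y * Et * St)
          ≈⟨ *-congˡ (*-congʳ (*-congˡ (trans (E-≡ index₁) (sym (S-E s (r ℕ.* q)))))) ⟩
        E (r ℕ.* p) * E (r ℕ.* s) * (Y * (S s (r ℕ.* q) * E (r ℕ.* q)) * St)
          ≈⟨ rearrange (E (r ℕ.* p)) (E (r ℕ.* s)) Y (S s (r ℕ.* q)) (E (r ℕ.* q)) St ⟩
        E (r ℕ.* p) * E (r ℕ.* q) * Y * S s (r ℕ.* q) * (St * E (r ℕ.* s))
          ≈⟨ *-cong (*-congʳ Y-eq) (trans (S-E p t) (E-≡ index₂)) ⟩
        E (r ℕ.* N) * E r * S s (r ℕ.* q) * E (r ℕ.* (p ℕ.* s))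
          ≈⟨ *-congʳ (*-congʳ (*-congʳ (S-E r N))) ⟨
        S r N * E N * E r * S s (r ℕ.* q) * E (r ℕ.* (p ℕ.* s))
          ≈⟨ rearrange′ (S r N) (E N) (E r) (S s (r ℕ.* q)) (E (r ℕ.* (p ℕ.* s))) ⟩
        E N * (S r N * S s (r ℕ.* q) * (E (r ℕ.* (p ℕ.* s)) * E r))
          ≈⟨ *-congˡ (*-congˡ V-eq) ⟨
        E N * (S r N * S s (r ℕ.* q) * (E (r ℕ.* p) * E (r ℕ.* s) * V))
          ≈⟨ rearrange″ (E N) (S r N) (S s (r ℕ.* q)) (E (r ℕ.* p) * E (r ℕ.* s)) V ⟩
        E (r ℕ.* p) * E (r ℕ.* s) * (E N * H₀) ∎)
        where
        index₁ : q ℕ.* t ≡ s ℕ.* (r ℕ.* q)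
        index₁ = N.solve 3 (λ q r s → q N.:* (r N.:* s) N.:= s N.:* (r N.:* q)) ≡.refl q r s
        index₂ : p ℕ.* t ≡ r ℕ.* (p ℕ.* s)
        index₂ = N.solve 3 (λ p r s → p N.:* (r N.:* s) N.:= r N.:* (p N.:* s)) ≡.refl p r s
        rearrange : ∀ a b y u c w → a * b * (y * (u * c) * w) ≈ a * c * y * u * (w * b)
        rearrange = solve 6 (λ a b y u c w → a :* b :* (y :* (u :* c) :* w)
                                           := a :* c :* y :* u :* (w :* b)) refl
        rearrange′ : ∀ a n e u w → a * n * e * u * w ≈ n * (a * u * (w * e))
        rearrange′ = solve 5 (λ a n e u w → a :* n :* e :* u :* w := n :* (a :* u :* (w :* e))) refl
        rearrange″ : ∀ n a u e v → n * (a * u * (e * v)) ≈ e * (n * (a * u * v))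
        rearrange″ = solve 5 (λ n a u e v → n :* (a :* u :* (e :* v)) := e :* (n :* (a :* u :* v))) refl

      -- Modulo E (p q), x is the power t = r s of itself, and E (q t) and S p t absorb the
      -- denominator of Y.
      YEqS₁ : Y * Eq * S₁ ≈ E N * H
      YEqS₁ = begin
        Y * Eq * S₁
          ≈⟨ *-congʳ (*-congˡ (proj₂ (proj₂ (E-shift N t j k eq q)))) ⟩
        Y * (Et + E N * z₂) * S₁
          ≈⟨ rearrange Y Et (E N) z₂ S₁ ⟩
        Y * Et * S₁ + E N * (Y * z₂ * S₁)
          ≈⟨ +-congʳ (*-congˡ (proj₂ (proj₂ (S-shift N t j k eq p)))) ⟩
        Y * Et * (St + E N * z₁) + E N * (Y * z₂ * S₁)
          ≈⟨ rearrange′ Y Et St (E N) z₁ z₂ S₁ ⟩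
        Y * Et * St + E N * (Y * (z₂ * S₁ + Et * z₁))
          ≈⟨ +-congʳ YEtSt ⟩
        E N * H₀ + E N * (Y * (z₂ * S₁ + Et * z₁))
          ≈⟨ distribˡ _ _ _ ⟨
        E N * H ∎
        where
        rearrange : ∀ y e n z s → y * (e + n * z) * s ≈ y * e * s + n * (y * z * s)
        rearrange = solve 5 (λ y e n z s → y :* (e :+ n :* z) :* s
                                         := y :* e :* s :+ n :* (y :* z :* s)) refl
        rearrange′ : ∀ y e u n z w s → y * e * (u + n * z) + n * (y * w * s)
                                     ≈ y * e * u + n * (y * (w * s + e * z))
        rearrange′ = solve 7 (λ y e u n z w s → y :* e :* (u :+ n :* z) :+ n :* (y :* w :* s)
                                     := y :* e :* u :+ n :* (y :* (w :* s :+ e :* z))) refl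

      S₁E₁ : S₁ * E 1 ≈ Ep
      S₁E₁ = trans (S-E p 1) (E-≡ (ℕ.*-identityʳ p))

    -- Since x^pq - 1 = `S₁ * Eq * F`, cancelling `S₁ * Eq` in `YEqS₁` leaves `Y ≈ F * H`. The
    -- factor in front of `W` is the form in which the product over the proper divisors of pqr will
    -- appear.
    Φ₃-exists : ∀ F → E p * E q * F ≈ E (p ℕ.* q) * E 1 →
                ∃ λ W → P W × E (q ℕ.* r) * S p r * F * W ≈ E (p ℕ.* (q ℕ.* r))
    Φ₃-exists F F-eq = H , P-H , E-regular r (begin
      E r * (E (q ℕ.* r) * S p r * F * H)
        ≈⟨ rearrange (E r) (E (q ℕ.* r)) (S p r) F H ⟩
      E (q ℕ.* r) * (S p r * E r) * (F * H)
        ≈⟨ *-cong (*-cong (E-≡ (ℕ.*-comm q r)) (trans (S-E p r) (E-≡ (ℕ.*-comm p r)))) (sym Y≈FH) ⟩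
      E (r ℕ.* q) * E (r ℕ.* p) * Y
        ≈⟨ *-congʳ (*-comm _ _) ⟩
      E (r ℕ.* p) * E (r ℕ.* q) * Y
        ≈⟨ Y-eq ⟩
      E (r ℕ.* N) * E r
        ≈⟨ trans (*-comm _ _) (*-congˡ (E-≡ index)) ⟩
      E r * E (p ℕ.* (q ℕ.* r)) ∎)
      where
      index : r ℕ.* N ≡ p ℕ.* (q ℕ.* r)
      index = N.solve 3 (λ p q r → r N.:* (p N.:* q) N.:= p N.:* (q N.:* r)) ≡.refl p q r
      rearrange : ∀ e a b f h → e * (a * b * f * h) ≈ a * (b * e) * (f * h)
      rearrange = solve 5 (λ e a b f h → e :* (a :* b :* f :* h) := a :* (b :* e) :* (f :* h)) refl
      EN≈ : E N ≈ S₁ * Eq * F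
      EN≈ = E-regular 1 (begin
        E 1 * E N             ≈⟨ *-comm _ _ ⟩
        E N * E 1             ≈⟨ F-eq ⟨
        Ep * Eq * F           ≈⟨ *-congʳ (*-congʳ S₁E₁) ⟨
        S₁ * E 1 * Eq * F     ≈⟨ rearrange₁ _ _ _ _ ⟩
        E 1 * (S₁ * Eq * F)   ∎)
        where
        rearrange₁ : ∀ s e f g → s * e * f * g ≈ e * (s * f * g)
        rearrange₁ = solve 4 (λ s e f g → s :* e :* f :* g := e :* (s :* f :* g)) refl
      Y≈FH : Y ≈ F * H
      Y≈FH = regular-* (E-regular q) (regular-factorˡ S₁E₁ (E-regular p)) (begin
        Eq * S₁ * Y         ≈⟨ rearrange₁ _ _ _ ⟩
        Y * Eq * S₁         ≈⟨ YEqS₁ ⟩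
        E N * H             ≈⟨ *-congʳ EN≈ ⟩
        S₁ * Eq * F * H     ≈⟨ rearrange₂ _ _ _ _ ⟩
        Eq * S₁ * (F * H)   ∎)
        where
        rearrange₁ : ∀ e s y → e * s * y ≈ y * e * s
        rearrange₁ = solve 3 (λ e s y → e :* s :* y := y :* e :* s) refl
        rearrange₂ : ∀ s e f h → s * e * f * h ≈ e * s * (f * h)
        rearrange₂ = solve 4 (λ s e f h → s :* e :* f :* h := e :* s :* (f :* h)) refl

  -- Lam and Leung's formula; a, b, c, d are ρ + 1, σ + 1, q − 1 − ρ, p − 1 − σ.
  lamLeung : ∀ p q .{{_ : NonZero p}} .{{_ : NonZero q}} a b c d →
    a ℕ.+ c ≡ q → b ℕ.+ d ≡ p → a ℕ.* p ℕ.+ b ℕ.* q ≡ p ℕ.* q ℕ.+ 1 →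
    ∀ F → E p * E q * F ≈ E (p ℕ.* q) * E 1 →
    F ≈ S a p * S b q - X 1 * (S c p * S d q)
  lamLeung p q a b c d a+c b+d ab F F-eq = regular-* (E-regular p) (E-regular q) (begin
    E p * E q * F
      ≈⟨ F-eq ⟩
    E (p ℕ.* q) * E 1
      ≈⟨ E*E t x ⟩
    t * x - t - x + 1#
      ≈⟨ +-congʳ (+-congʳ (+-congʳ uv≈)) ⟨
    u * v - t - x + 1#
      ≈⟨ main ⟩
    E (a ℕ.* p) * E (b ℕ.* q) - x * (E (c ℕ.* p) * E (d ℕ.* q))
      ≈⟨ +-cong (*-cong (sym (S-E a p)) (sym (S-E b q)))
                (-‿cong (*-congˡ (*-cong (sym (S-E c p)) (sym (S-E d q))))) ⟩
    S a p * E p * (S b q * E q) - x * (S c p * E p * (S d q * E q))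
      ≈⟨ collect (S a p) (S b q) (S c p) (S d q) (E p) (E q) x ⟩
    E p * E q * (S a p * S b q - x * (S c p * S d q)) ∎)
    where
    t = X (p ℕ.* q)
    x = X 1
    u = X (a ℕ.* p)
    v = X (b ℕ.* q)
    z = X (c ℕ.* p)
    w = X (d ℕ.* q)
    cp : a ℕ.* p ℕ.+ c ℕ.* p ≡ p ℕ.* q
    cp = ≡.trans (≡.sym (ℕ.*-distribʳ-+ p a c)) (≡.trans (cong (ℕ._* p) a+c) (ℕ.*-comm q p))
    dq : b ℕ.* q ℕ.+ d ℕ.* q ≡ p ℕ.* q
    dq = ≡.trans (≡.sym (ℕ.*-distribʳ-+ q b d)) (cong (ℕ._* q) b+d)
    +-suc-1 : ∀ m n → m ℕ.+ (1 ℕ.+ n) ≡ m ℕ.+ n ℕ.+ 1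
    +-suc-1 m n = ≡.trans (ℕ.+-suc m n) (ℕ.+-comm 1 (m ℕ.+ n))
    -- Subtract ap + cp = pq from ap + bq = pq + 1; for `d1`, subtract bq + dq = pq.
    c1 : 1 ℕ.+ c ℕ.* p ≡ b ℕ.* q
    c1 = ℕ.+-cancelˡ-≡ (a ℕ.* p) _ _ (≡.trans (+-suc-1 (a ℕ.* p) (c ℕ.* p))
           (≡.trans (cong (ℕ._+ 1) cp) (≡.sym ab)))
    d1 : 1 ℕ.+ d ℕ.* q ≡ a ℕ.* p
    d1 = ℕ.+-cancelˡ-≡ (b ℕ.* q) _ _ (≡.trans (+-suc-1 (b ℕ.* q) (d ℕ.* q))
           (≡.trans (cong (ℕ._+ 1) dq) (≡.trans (≡.sym ab) (ℕ.+-comm (a ℕ.* p) _))))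
    xz≈v : x * z ≈ v
    xz≈v = trans (sym (X-+ 1 _)) (X-≡ c1)
    xw≈u : x * w ≈ u
    xw≈u = trans (sym (X-+ 1 _)) (X-≡ d1)
    uz≈t : u * z ≈ t
    uz≈t = trans (sym (X-+ _ _)) (X-≡ cp)
    uv≈ : u * v ≈ t * x
    uv≈ = trans (sym (X-+ _ _)) (trans (X-≡ ab) (X-+ _ 1))
    xzw≈t : x * (z * w) ≈ t
    xzw≈t = trans (rearrange x z w) (trans (*-congʳ xw≈u) uz≈t)
      where
      rearrange : ∀ x z w → x * (z * w) ≈ x * w * z
      rearrange = solve 3 (λ x z w → x :* (z :* w) := x :* w :* z) refl
    E*E : ∀ f g → (f - 1#) * (g - 1#) ≈ f * g - f - g + 1#
    E*E f g = begin
      (f - 1#) * (g - 1#)               ≈⟨ expand f g 1# ⟩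
      f * g - f * 1# - g * 1# + 1# * 1#
        ≈⟨ +-cong (+-cong (+-congˡ (-‿cong (*-identityʳ f))) (-‿cong (*-identityʳ g))) (*-identityʳ 1#) ⟩
      f * g - f - g + 1#                ∎
      where
      expand : ∀ f g o → (f - o) * (g - o) ≈ f * g - f * o - g * o + o * o
      expand = solve 3 (λ f g o → (f :- o) :* (g :- o) := f :* g :- f :* o :- g :* o :+ o :* o) refl
    -- By xz = v, xw = u and xzw = uz = t, the product x(z - 1)(w - 1) is t - v - u + x, so u and v
    -- cancel against the expansion of (u - 1)(v - 1).
    main : u * v - t - x + 1# ≈ E (a ℕ.* p) * E (b ℕ.* q) - x * (E (c ℕ.* p) * E (d ℕ.* q))
    main = begin
      u * v - t - x + 1#
        ≈⟨ insert (u * v) t x 1# u v ⟩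
      u * v - u - v + 1# - (t - v - u + x)
        ≈⟨ +-congˡ (-‿cong (+-cong (+-cong (+-cong xzw≈t (-‿cong xz≈v)) (-‿cong xw≈u)) (*-identityʳ x))) ⟨
      u * v - u - v + 1# - (x * (z * w) - x * z - x * w + x * 1#)
        ≈⟨ +-congˡ (-‿cong (factor x z w 1#)) ⟩
      u * v - u - v + 1# - x * (z * w - z - w + 1#)
        ≈⟨ +-cong (E*E u v) (-‿cong (*-congˡ (E*E z w))) ⟨
      E (a ℕ.* p) * E (b ℕ.* q) - x * (E (c ℕ.* p) * E (d ℕ.* q)) ∎
      where
      insert : ∀ m t x o u v → m - t - x + o ≈ m - u - v + o - (t - v - u + x)
      insert = solve 6 (λ m t x o u v → m :- t :- x :+ o := m :- u :- v :+ o :- (t :- v :- u :+ x)) refl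
      factor : ∀ x z w o → x * (z * w) - x * z - x * w + x * o ≈ x * (z * w - z - w + o)
      factor = solve 4 (λ x z w o → x :* (z :* w) :- x :* z :- x :* w :+ x :* o
                                  := x :* (z :* w :- z :- w :+ o)) refl
    collect : ∀ a b c d e f x → a * e * (b * f) - x * (c * e * (d * f)) ≈ e * f * (a * b - x * (c * d))
    collect = solve 7 (λ a b c d e f x → a :* e :* (b :* f) :- x :* (c :* e :* (d :* f))
                                       := e :* f :* (a :* b :- x :* (c :* d))) refl

  -- The next identities are used for long division of series; they are stated in the abstract
  -- ring because the solver unfolds the operations of a concrete one.
  subPrefix-identity : ∀ x c b g k u v →
    (x - c * b) * (g * k) + (u - c * (k * v)) ≈ x * (g * k) + u - c * (k * (b * g + v))
  subPrefix-identity = solve 7 (λ x c b g k u v →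
    (x :- c :* b) :* (g :* k) :+ (u :- c :* (k :* v))
    := x :* (g :* k) :+ u :- c :* (k :* (b :* g :+ v))) refl

  divStep-identity : ∀ c g k u v →
    u - c * (k * v) ≈ c * (g * k) + u - (g + v) * (c * k)
  divStep-identity = solve 5 (λ c g k u v →
    u :- c :* (k :* v) := c :* (g :* k) :+ u :- (g :+ v) :* (c :* k)) refl

  distribˡ-- : ∀ g h k → g * h - g * k ≈ g * (h - k)
  distribˡ-- = solve 3 (λ g h k → g :* h :- g :* k := g :* (h :- k)) refl

  cancel-+- : ∀ a b → a + (b - a) ≈ b
  cancel-+- = solve 2 (λ a b → a :+ (b :- a) := b) refl

  Φ₂-exists : ∀ p q .{{_ : NonZero p}} .{{_ : NonZero q}} → Coprime p q →
              ∃ λ W → P W × E p * E q * W ≈ E (p ℕ.* q) * E 1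
  Φ₂-exists p q p⊥q = let W , PW , W-eq = Φ-exists 1 p q p⊥q in W , PW , unscale W-eq
    where
    unscale : ∀ {W} → IsΦ 1 p q W → E p * E q * W ≈ E (p ℕ.* q) * E 1
    unscale W-eq = trans (*-congʳ (*-cong (E-≡ (≡.sym (ℕ.*-identityˡ p))) (E-≡ (≡.sym (ℕ.*-identityˡ q)))))
      (trans W-eq (*-congʳ (E-≡ (ℕ.*-identityˡ (p ℕ.* q)))))

  S*E1 : ∀ a → S a 1 * E 1 ≈ E a
  S*E1 a = trans (S-E a 1) (E-≡ (ℕ.*-identityʳ a))

  -- The factors stand in the order and bracketing of the product over the proper divisors,
  -- including the closing `1#` of the fold; likewise in `properProduct₂` and `properProduct₃`.
  properProduct₁ : ∀ a → E 1 * 1# * S a 1 ≈ E a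
  properProduct₁ a = trans (*-congʳ (*-identityʳ (E 1))) (trans (*-comm _ _) (S*E1 a))

  properProduct₂ : ∀ a b W → E a * E b * W ≈ E (a ℕ.* b) * E 1 →
                   S a 1 * (S b 1 * (E 1 * 1#)) * W ≈ E (a ℕ.* b)
  properProduct₂ a b W W-eq = E-regular 1 (begin
    E 1 * (S a 1 * (S b 1 * (E 1 * 1#)) * W)
      ≈⟨ *-congˡ (*-congʳ (*-congˡ (*-congˡ (*-identityʳ (E 1))))) ⟩
    E 1 * (S a 1 * (S b 1 * E 1) * W)
      ≈⟨ rearrange (E 1) (S a 1) (S b 1) W ⟩
    S a 1 * E 1 * (S b 1 * E 1) * W
      ≈⟨ *-congʳ (*-cong (S*E1 a) (S*E1 b)) ⟩
    E a * E b * W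
      ≈⟨ W-eq ⟩
    E (a ℕ.* b) * E 1
      ≈⟨ *-comm _ _ ⟩
    E 1 * E (a ℕ.* b) ∎)
    where
    rearrange : ∀ e s t w → e * (s * (t * e) * w) ≈ s * e * (t * e) * w
    rearrange = solve 4 (λ e s t w → e :* (s :* (t :* e) :* w) := s :* e :* (t :* e) :* w) refl

  -- For distinct primes this is the identity Φ_ab(x) Φ_a(x) = Φ_a(x^b).
  Φ₂*S : ∀ a b .{{_ : NonZero b}} W → E a * E b * W ≈ E (a ℕ.* b) * E 1 → W * S a 1 ≈ S a b
  Φ₂*S a b W W-eq = regular-* (E-regular 1) (E-regular b) (begin
    E 1 * E b * (W * S a 1)
      ≈⟨ rearrange (E 1) (E b) W (S a 1) ⟩
    S a 1 * E 1 * E b * W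
      ≈⟨ *-congʳ (*-congʳ (S*E1 a)) ⟩
    E a * E b * W
      ≈⟨ W-eq ⟩
    E (a ℕ.* b) * E 1
      ≈⟨ *-congʳ (S-E a b) ⟨
    S a b * E b * E 1
      ≈⟨ rearrange′ (S a b) (E b) (E 1) ⟩
    E 1 * E b * S a b ∎)
    where
    rearrange : ∀ e f w s → e * f * (w * s) ≈ s * e * f * w
    rearrange = solve 4 (λ e f w s → e :* f :* (w :* s) := s :* e :* f :* w) refl
    rearrange′ : ∀ s f e → s * f * e ≈ e * f * s
    rearrange′ = solve 3 (λ s f e → s :* f :* e := e :* f :* s) refl

  -- The divisors of qr together give x^qr - 1, the divisors p and pr give Φ_p(xʳ), and pq is left
  -- over.
  properProduct₃ : ∀ p q r .{{_ : NonZero r}} Fpq Fpr Fqr →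
    E p * E r * Fpr ≈ E (p ℕ.* r) * E 1 → E q * E r * Fqr ≈ E (q ℕ.* r) * E 1 →
    Fpq * (Fpr * (S p 1 * (Fqr * (S q 1 * (S r 1 * (E 1 * 1#)))))) ≈ E (q ℕ.* r) * S p r * Fpq
  properProduct₃ p q r Fpq Fpr Fqr pr qr = begin
    Fpq * (Fpr * (S p 1 * (Fqr * (S q 1 * (S r 1 * (E 1 * 1#))))))
      ≈⟨ rearrange Fpq Fpr (S p 1) Fqr (S q 1 * (S r 1 * (E 1 * 1#))) ⟩
    S q 1 * (S r 1 * (E 1 * 1#)) * Fqr * (Fpr * S p 1) * Fpq
      ≈⟨ *-congʳ (*-cong (properProduct₂ q r Fqr qr) (Φ₂*S p r Fpr pr)) ⟩
    E (q ℕ.* r) * S p r * Fpq ∎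
    where
    rearrange : ∀ f g s h u → f * (g * (s * (h * u))) ≈ u * h * (g * s) * f
    rearrange = solve 5 (λ f g s h u → f :* (g :* (s :* (h :* u))) := u :* h :* (g :* s) :* f) refl

  -- With denominators cleared, both sides are built from monic factors of known degree, from which
  -- the bound τ on the degree of `S p r * F` is read off.
  EEE*SF : ∀ p q r F → E p * E q * F ≈ E (p ℕ.* q) * E 1 →
           E p * E q * E r * (S p r * F) ≈ E (p ℕ.* q) * E 1 * E (p ℕ.* r)
  EEE*SF p q r F F-eq = begin
    E p * E q * E r * (S p r * F)     ≈⟨ rearrange (E p * E q) (E r) (S p r) F ⟩
    E p * E q * F * (S p r * E r)     ≈⟨ *-cong F-eq (S-E p r) ⟩
    E (p ℕ.* q) * E 1 * E (p ℕ.* r)   ∎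
    where
    rearrange : ∀ e f s g → e * f * (s * g) ≈ e * g * (s * f)
    rearrange = solve 4 (λ e f s g → e :* f :* (s :* g) := e :* g :* (s :* f)) refl

  distribute : ∀ s a b x c d → s * (a * b - x * (c * d)) ≈ a * (s * b) - x * (c * (s * d))
  distribute = solve 6 (λ s a b x c d → s :* (a :* b :- x :* (c :* d))
                                      := a :* (s :* b) :- x :* (c :* (s :* d))) refl

  exchange : ∀ a s b → a * (s * b) ≈ b * (s * a)
  exchange = solve 3 (λ a s b → a :* (s :* b) := b :* (s :* a)) refl

-- Coefficient lists as series, and series of finite support

module Polynomials where

  open PowerSeries
  open import Algebra.Bundles using (CommutativeRing)
  open import Algebra.Solver.Ring.AlmostCommutativeRing
    using (fromCommutativeRing; _-Raw-AlmostCommutative⟶_)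
  open import Data.Bool using (if_then_else_)
  open import Data.Integer as ℤ using (ℤ; +_; -[1+_]; _+_; _*_; -_)
  import Data.Integer.Properties as ℤ
  open import Data.List using ([]; _∷_; _++_; [_]; length; map; replicate)
  open import Data.Nat as ℕ using (ℕ; zero; suc; NonZero; _≤_; _<_; z≤n; s≤s)
  open import Data.Nat.Divisibility using (_∣?_; ∣m+n∣m⇒∣n; ∣m∣n⇒∣m+n; ∣-refl; ∣⇒≤; _∣0)
  import Data.Nat.Properties as ℕ
  open import Data.Product using (∃; _,_)
  open import Function using (_∘_)
  open import Relation.Binary.PropositionalEquality hiding ([_]; setoid)
  open import Relation.Nullary using (yes; no; does; contradiction)
  open import Relation.Nullary.Decidable using (dec-true; dec-false)

  open CommutativeRing seriesRing public using (0#; 1#; setoid; *-congˡ; *-congʳ; ring)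
    renaming ( refl to ≈-refl; sym to ≈-sym; trans to ≈-trans; *-comm to ⊛-comm≈
             ; *-assoc to ⊛-assoc≈; *-identityˡ to ⊛-identityˡ≈; *-identityʳ to ⊛-identityʳ≈
             ; +-cong to ⊕-cong; -‿cong to ⊖-cong; _-_ to _⊖⊖_; distribʳ to distribʳ≈)

  coeff : Poly → Series
  coeff []      n       = + 0
  coeff (a ∷ f) zero    = a
  coeff (a ∷ f) (suc n) = coeff f n

  coeff-padd : ∀ f g n → coeff (padd f g) n ≡ coeff f n + coeff g n
  coeff-padd []      g       n       = sym (ℤ.+-identityˡ _)
  coeff-padd (a ∷ f) []      n       = sym (ℤ.+-identityʳ _)
  coeff-padd (a ∷ f) (b ∷ g) zero    = refl
  coeff-padd (a ∷ f) (b ∷ g) (suc n) = coeff-padd f g n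

  coeff-scale : ∀ c f n → coeff (map (c *_) f) n ≡ c * coeff f n
  coeff-scale c []      n       = sym (ℤ.*-zeroʳ c)
  coeff-scale c (a ∷ f) zero    = refl
  coeff-scale c (a ∷ f) (suc n) = coeff-scale c f n

  coeff-pmul : ∀ f g → coeff (pmul f g) ≈ coeff f ⊛ coeff g
  coeff-pmul f g = pointwise (go f)
    where
    go : ∀ f n → coeff (pmul f g) n ≡ (coeff f ⊛ coeff g) n
    go []      n       = sym (0⊛ (coeff g) n)
    go (a ∷ f) zero    = trans (coeff-padd (map (a *_) g) _ 0)
      (trans (ℤ.+-identityʳ _) (coeff-scale a g 0))
    go (a ∷ f) (suc n) = trans (coeff-padd (map (a *_) g) _ (suc n))
      (cong₂ _+_ (coeff-scale a g (suc n)) (go f n))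

  shift : Series → Series
  shift f zero    = + 0
  shift f (suc n) = f n

  shift-⊛ : ∀ f g n → (shift f ⊛ g) (suc n) ≡ (f ⊛ g) n
  shift-⊛ f g n = trans (cong (λ a → a + (f ⊛ g) n) (ℤ.*-zeroˡ (g (suc n)))) (ℤ.+-identityˡ _)

  X : ℕ → Series
  X zero    = const (+ 1)
  X (suc n) = shift (X n)

  X-⊛-≥ : ∀ n f k → (X n ⊛ f) (n ℕ.+ k) ≡ f k
  X-⊛-≥ zero    f k = ⊛-identityˡ f k
  X-⊛-≥ (suc n) f k = trans (shift-⊛ (X n) f (n ℕ.+ k)) (X-⊛-≥ n f k)

  X-⊛-< : ∀ n f {k} → k < n → (X n ⊛ f) k ≡ + 0
  X-⊛-< (suc n) f {zero}  _         = ℤ.*-zeroˡ (f 0)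
  X-⊛-< (suc n) f {suc k} (s≤s k<n) = trans (shift-⊛ (X n) f k) (X-⊛-< n f k<n)

  data Position (n : ℕ) : ℕ → Set where
    below : ∀ {k} → k < n → Position n k
    above : ∀ k → Position n (n ℕ.+ k)

  position : ∀ n k → Position n k
  position zero    k       = above k
  position (suc n) zero    = below (s≤s z≤n)
  position (suc n) (suc k) with position n k
  ... | below k<n = below (s≤s k<n)
  ... | above k   = above k

  X-diag : ∀ n → X n n ≡ + 1
  X-diag zero    = refl
  X-diag (suc n) = X-diag n

  X-off : ∀ n k → n ≢ k → X n k ≡ + 0
  X-off zero    zero    n≢k = contradiction refl n≢k
  X-off zero    (suc k) n≢k = refl
  X-off (suc n) zero    n≢k = refl
  X-off (suc n) (suc k) n≢k = X-off n k (n≢k ∘ cong suc)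

  X-+ : ∀ a b → X (a ℕ.+ b) ≈ X a ⊛ X b
  X-+ a b = pointwise λ k → sym (go a k)
    where
    go : ∀ a k → (X a ⊛ X b) k ≡ X (a ℕ.+ b) k
    go zero    k       = ⊛-identityˡ (X b) k
    go (suc a) zero    = ℤ.*-zeroˡ (X b 0)
    go (suc a) (suc k) = trans (shift-⊛ (X a) (X b) k) (go a k)

  coeff-++ : ∀ f g → coeff (f ++ g) ≈ coeff f ⊕ X (length f) ⊛ coeff g
  coeff-++ f g = pointwise (go f)
    where
    go : ∀ f n → coeff (f ++ g) n ≡ coeff f n + (X (length f) ⊛ coeff g) n
    go []      n       = sym (trans (ℤ.+-identityˡ _) (⊛-identityˡ (coeff g) n))
    go (a ∷ f) zero    = sym (trans (cong (_+_ a) (ℤ.*-zeroˡ (coeff g 0))) (ℤ.+-identityʳ a))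
    go (a ∷ f) (suc n) = trans (go f n) (cong (_+_ (coeff f n))
      (sym (shift-⊛ (X (length f)) (coeff g) n)))

  coeff-xnm1 : ∀ n → coeff (xnm1 n) ≈ X n ⊖⊖ 1#
  coeff-xnm1 zero    = pointwise λ { zero → refl ; (suc n) → refl }
  coeff-xnm1 (suc n) = pointwise λ { zero → refl ; (suc k) → trans (go n k) (sym (ℤ.+-identityʳ _)) }
    where
    go : ∀ n k → coeff (replicate n (+ 0) ++ [ + 1 ]) k ≡ X n k
    go zero    zero    = refl
    go zero    (suc k) = refl
    go (suc n) zero    = refl
    go (suc n) (suc k) = go n k

  E-unit : ∀ n .{{_ : NonZero n}} → ∃ λ u → u ⊛ (X n ⊖⊖ 1#) ≈ 1#
  E-unit n = u , ≈-trans (⊛-comm≈ u _) (pointwise λ t → trans (expand t) (inverse t (position n t)))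
    where
    -- 1 / (xⁿ − 1) = −1 − xⁿ − x²ⁿ − ….
    u : Series
    u t = if does (n ∣? t) then -[1+ 0 ] else + 0
    u-periodic : ∀ k → u (n ℕ.+ k) ≡ u k
    u-periodic k with n ∣? k
    ... | yes n∣k rewrite dec-true (n ∣? (n ℕ.+ k)) (∣m∣n⇒∣m+n ∣-refl n∣k) = refl
    ... | no  n∤k rewrite dec-false (n ∣? (n ℕ.+ k)) (λ d → n∤k (∣m+n∣m⇒∣n d ∣-refl)) = refl
    expand : ∀ t → ((X n ⊖⊖ 1#) ⊛ u) t ≡ (X n ⊛ u) t + - u t
    expand t = trans (⊛-distribʳ u (X n) (⊖ 1#) t) (cong (_+_ ((X n ⊛ u) t)) (negate t))
      where
      negate : ∀ t → ((⊖ 1#) ⊛ u) t ≡ - u t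
      negate t = trans (at (⊛-cong {⊖ 1#} {const -[1+ 0 ]} {u} {u}
          (pointwise λ { zero → refl ; (suc _) → refl }) ≈-refl) t)
        (trans (const-⊛ -[1+ 0 ] u t) (ℤ.-1*i≡-i (u t)))
    inverse-< : ∀ t → t < n → (X n ⊛ u) t + - u t ≡ 1# t
    inverse-< zero t<n rewrite X-⊛-< n u t<n | dec-true (n ∣? 0) (n ∣0) = refl
    inverse-< (suc t) t<n rewrite X-⊛-< n u t<n
      | dec-false (n ∣? suc t) (λ d → ℕ.<⇒≱ t<n (∣⇒≤ d)) = refl
    inverse : ∀ t → Position n t → (X n ⊛ u) t + - u t ≡ 1# t
    inverse t (below t<n) = inverse-< t t<n
    inverse _ (above k) = trans (trans (cong₂ (λ a b → a + - b) (X-⊛-≥ n u k) (u-periodic k))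
      (ℤ.+-inverseʳ (u k))) (sym (1#≡0 n))
      where
      1#≡0 : ∀ n .{{_ : NonZero n}} → 1# (n ℕ.+ k) ≡ + 0
      1#≡0 (suc n) = refl

  VanishesFrom : ℕ → Series → Set
  VanishesFrom N f = ∀ n → N ≤ n → f n ≡ + 0

  IsPoly : Series → Set
  IsPoly f = ∃ λ N → VanishesFrom N f

  vanish-≤ : ∀ {M N f} → M ≤ N → VanishesFrom M f → VanishesFrom N f
  vanish-≤ M≤N v n N≤n = v n (ℕ.≤-trans M≤N N≤n)

  vanish-⊕ : ∀ {N f g} → VanishesFrom N f → VanishesFrom N g → VanishesFrom N (f ⊕ g)
  vanish-⊕ v w n N≤n = cong₂ _+_ (v n N≤n) (w n N≤n)

  vanish-⊖ : ∀ {N f} → VanishesFrom N f → VanishesFrom N (⊖ f)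
  vanish-⊖ v n N≤n = cong -_ (v n N≤n)

  vanish-0 : ∀ f g → (∀ n → f n ≡ + 0) → ∀ n → (f ⊛ g) n ≡ + 0
  vanish-0 f g f≡0 n = trans (at (⊛-cong {f} {λ _ → + 0} {g} {g} (pointwise f≡0) ≈-refl) n) (0⊛ g n)

  vanish-⊛ : ∀ a b f g → VanishesFrom a f → VanishesFrom b g → VanishesFrom (a ℕ.+ b) (f ⊛ g)
  vanish-⊛ zero    b f g v w n       _           = vanish-0 f g (λ n → v n z≤n) n
  vanish-⊛ (suc a) b f g v w (suc n) (s≤s a+b≤n)
    rewrite w (suc n) (ℕ.m≤n⇒m≤1+n (ℕ.≤-trans (ℕ.m≤n+m b a) a+b≤n))
          | ℤ.*-zeroʳ (f 0)
          | vanish-⊛ a b (f ∘ suc) g (λ n a≤n → v (suc n) (s≤s a≤n)) w n a+b≤n = refl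

  ⊛-top : ∀ a b f g → VanishesFrom (suc a) f → VanishesFrom (suc b) g →
          (f ⊛ g) (a ℕ.+ b) ≡ f a * g b
  ⊛-top zero    zero    f g v w = refl
  ⊛-top zero    (suc b) f g v w
    rewrite vanish-0 (f ∘ suc) g (λ n → v (suc n) (s≤s z≤n)) b = ℤ.+-identityʳ _
  ⊛-top (suc a) b       f g v w
    rewrite w (suc (a ℕ.+ b)) (s≤s (ℕ.m≤n+m b a))
          | ℤ.*-zeroʳ (f 0) | ⊛-top a b (f ∘ suc) g (λ n a≤n → v (suc n) (s≤s a≤n)) w
    = ℤ.+-identityˡ _

  vanish-coeff : ∀ f → VanishesFrom (length f) (coeff f)
  vanish-coeff []      n       _         = refl
  vanish-coeff (a ∷ f) (suc n) (s≤s f≤n) = vanish-coeff f n f≤n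

  IsPoly-resp : ∀ {f g} → f ≈ g → IsPoly f → IsPoly g
  IsPoly-resp f≈g (N , v) = N , λ n N≤n → trans (sym (at f≈g n)) (v n N≤n)

  vanish-X : ∀ n → VanishesFrom (suc n) (X n)
  vanish-X n k n<k = X-off n k (ℕ.<⇒≢ n<k)

  IsPoly-⊕ : ∀ {f g} → IsPoly f → IsPoly g → IsPoly (f ⊕ g)
  IsPoly-⊕ {f} {g} (M , v) (N , w) = M ℕ.⊔ N ,
    vanish-⊕ {f = f} {g} (vanish-≤ {f = f} (ℕ.m≤m⊔n M N) v) (vanish-≤ {f = g} (ℕ.m≤n⊔m M N) w)

  IsPoly-⊛ : ∀ {f g} → IsPoly f → IsPoly g → IsPoly (f ⊛ g)
  IsPoly-⊛ {f} {g} (M , v) (N , w) = M ℕ.+ N , vanish-⊛ M N f g v w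

  IsPoly-X⊛ : ∀ n {f} → IsPoly (X n ⊛ f) → IsPoly f
  IsPoly-X⊛ n {f} (N , v) = N , λ k N≤k →
    trans (sym (X-⊛-≥ n f k)) (v (n ℕ.+ k) (ℕ.≤-trans N≤k (ℕ.m≤n+m k n)))

  IsPoly-⊖ : ∀ {f} → IsPoly f → IsPoly (⊖ f)
  IsPoly-⊖ {f} (N , v) = N , vanish-⊖ {f = f} v

  ℤ⟶Series : ℤ.+-*-rawRing -Raw-AlmostCommutative⟶ fromCommutativeRing seriesRing
  ℤ⟶Series = record
    { ⟦_⟧ = const
    ; +-homo = λ a b → pointwise λ { zero → refl ; (suc n) → refl }
    ; *-homo = λ a b → pointwise λ n → sym (trans (const-⊛ a (const b) n) (scale a b n))
    ; -‿homo = λ a → pointwise λ { zero → refl ; (suc n) → refl }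
    ; 0-homo = ≈-refl
    ; 1-homo = ≈-refl }
    where
    scale : ∀ a b n → a * const b n ≡ const (a * b) n
    scale a b zero    = refl
    scale a b (suc n) = ℤ.*-zeroʳ a

  polynomials : SeriesRing
  polynomials = record
    { A = seriesRing
    ; ι = ℤ⟶Series
    ; X = X
    ; X-0 = ≈-refl
    ; X-+ = X-+
    ; E-unit = E-unit
    ; P = IsPoly
    ; P-resp = IsPoly-resp
    ; P-X = λ n → suc n , vanish-X n
    ; P-+ = λ {f} {g} → IsPoly-⊕ {f} {g}
    ; P-neg = λ {f} → IsPoly-⊖ {f}
    ; P-* = λ {f} {g} → IsPoly-⊛ {f} {g}
    ; P-X* = IsPoly-X⊛ }

  open Geometric polynomials public

-- Degrees, monic polynomials and correctness of long division

module LongDivision where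

  open PowerSeries
  open Polynomials
  open import Data.Bool using (true; false)
  open import Data.Integer as ℤ using (ℤ; +_; -[1+_])
  import Data.Integer.Properties as ℤ
  open import Data.List using (List; []; _∷_; length; reverse)
  open import Data.List.Properties using (unfold-reverse; length-reverse; reverse-involutive)
  open import Data.Nat as ℕ using (ℕ; zero; suc; NonZero; _≤_; _<_; _∸_; _<ᵇ_; z≤n; s≤s)
  import Data.Nat.Properties as ℕ
  open import Data.Product using (∃; _×_; _,_)
  open import Data.Sum using (_⊎_; inj₁; inj₂)
  open import Relation.Binary.Definitions using (tri<; tri≈; tri>)
  open import Relation.Binary.PropositionalEquality hiding ([_]; setoid)
  open import Relation.Nullary using (yes; no; contradiction; ofʸ; ofⁿ)
  import Relation.Binary.Reasoning.Setoid setoid as ≈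

  MonicOfDegree : ℕ → Series → Set
  MonicOfDegree m f = f m ≡ + 1 × VanishesFrom (suc m) f

  IsMonic : Series → Set
  IsMonic f = ∃ λ m → MonicOfDegree m f

  monic-resp : ∀ {f g} → f ≈ g → IsMonic f → IsMonic g
  monic-resp f≈g (m , lead , v) =
    m , trans (sym (at f≈g m)) lead , λ n m<n → trans (sym (at f≈g n)) (v n m<n)

  -- At n = a + b′ with b′ > b, view `g` as vanishing only beyond b′: then `⊛-top` gives the
  -- coefficient as f a · g b′, and g b′ = 0.
  vanish-⊛-tight : ∀ a b f g → VanishesFrom (suc a) f → VanishesFrom (suc b) g →
                   VanishesFrom (suc (a ℕ.+ b)) (f ⊛ g)
  vanish-⊛-tight a b f g v w n a+b<n = subst (λ k → (f ⊛ g) k ≡ + 0) index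
    (trans (⊛-top a b′ f g v (vanish-≤ {f = g} (s≤s b≤b′) w))
      (trans (cong (ℤ._*_ (f a)) (w b′ b<b′)) (ℤ.*-zeroʳ (f a))))
    where
    b′ = n ∸ a
    index : a ℕ.+ b′ ≡ n
    index = ℕ.m+[n∸m]≡n (ℕ.≤-trans (ℕ.m≤m+n a b) (ℕ.<⇒≤ a+b<n))
    b<b′ : b < b′
    b<b′ = ℕ.+-cancelˡ-< a b b′ (subst (a ℕ.+ b <_) (sym index) a+b<n)
    b≤b′ = ℕ.<⇒≤ b<b′

  degree-⊛ : ∀ {a b f g} → MonicOfDegree a f → MonicOfDegree b g → MonicOfDegree (a ℕ.+ b) (f ⊛ g)
  degree-⊛ {a} {b} {f} {g} (f₁ , v) (g₁ , w) =
    trans (⊛-top a b f g v w) (cong₂ ℤ._*_ f₁ g₁) , vanish-⊛-tight a b f g v w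

  monic-⊛ : ∀ {f g} → IsMonic f → IsMonic g → IsMonic (f ⊛ g)
  monic-⊛ {f} {g} (a , mf) (b , mg) = a ℕ.+ b , degree-⊛ {f = f} {g} mf mg

  -- Descent on a bound for the support of `h`. If `h N` is its last coefficient, it is also the
  -- coefficient of `f` at m + N; comparing this index with the degree n of `f` forces it to be 0 or
  -- 1, or contradicts that `f` has degree n.
  monic-quotient : ∀ {f g h} → IsMonic g → IsPoly h → IsMonic f → g ⊛ h ≈ f → IsMonic h
  monic-quotient {f} {g} {h} (m , g₁ , v) (N , w) (n , f₁ , u) gh≈f = go N w
    where
    top : ∀ N → VanishesFrom (suc N) h → f (m ℕ.+ N) ≡ h N
    top N w = trans (sym (at gh≈f (m ℕ.+ N))) (trans (⊛-top m N g h v w)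
      (trans (cong (ℤ._* h N) g₁) (ℤ.*-identityˡ (h N))))
    go : ∀ N → VanishesFrom N h → IsMonic h
    go zero w = contradiction (trans (sym f₁) (trans (sym (at gh≈f n))
      (trans (⊛-comm g h n) (vanish-0 h g (λ k → w k z≤n) n)))) λ ()
    go (suc N) w with h N ℤ.≟ + 0 | ℕ.<-cmp (m ℕ.+ N) n
    ... | yes hN≡0 | _ = go N λ k N≤k → case k N≤k
      where
      case : ∀ k → N ≤ k → h k ≡ + 0
      case k N≤k with ℕ.m≤n⇒m<n∨m≡n N≤k
      ... | inj₁ N<k  = w k N<k
      ... | inj₂ refl = hN≡0
    ... | no _ | tri< m+N<n _ _ = contradiction (trans (sym f₁) (trans (sym (at gh≈f n))
      (vanish-⊛-tight m N g h v w n m+N<n))) λ ()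
    ... | no _ | tri≈ _ m+N≡n _ = N , trans (sym (top N w)) (trans (cong f m+N≡n) f₁) , w
    ... | no hN≢0 | tri> _ _ n<m+N = contradiction (trans (sym (top N w)) (u _ n<m+N)) hN≢0

  -- The same descent: a last coefficient `h N` reappears at m + N in the product, hence is 0 as
  -- long as N ≥ K.
  vanish-quotient : ∀ {m K g h} → g m ≡ + 1 → VanishesFrom (suc m) g → IsPoly h →
                    VanishesFrom (m ℕ.+ K) (g ⊛ h) → VanishesFrom K h
  vanish-quotient {m} {K} {g} {h} g₁ v (N , w) z = go N w
    where
    go : ∀ N → VanishesFrom N h → VanishesFrom K h
    go zero    w = vanish-≤ {f = h} z≤n w
    go (suc N) w with ℕ.<-≤-connex N K
    ... | inj₁ N<K = vanish-≤ {f = h} N<K w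
    ... | inj₂ K≤N = go N case
      where
      hN≡0 : h N ≡ + 0
      hN≡0 = trans (sym (ℤ.*-identityˡ (h N))) (trans (cong (ℤ._* h N) (sym g₁))
        (trans (sym (⊛-top m N g h v w)) (z (m ℕ.+ N) (ℕ.+-monoʳ-≤ m K≤N))))
      case : ∀ k → N ≤ k → h k ≡ + 0
      case k N≤k with ℕ.m≤n⇒m<n∨m≡n N≤k
      ... | inj₁ N<k  = w k N<k
      ... | inj₂ refl = hN≡0

  degree-E : ∀ n .{{_ : NonZero n}} → MonicOfDegree n (E n)
  degree-E n@(suc k) = cong (λ a → a ℤ.- + 0) (X-diag n) ,
    λ { (suc j) n<j → cong (λ a → a ℤ.- + 0) (vanish-X n (suc j) n<j) }

  monic-E : ∀ n .{{_ : NonZero n}} → IsMonic (E n)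
  monic-E n = n , degree-E n

  monic-S : ∀ k a .{{_ : NonZero k}} .{{_ : NonZero a}} → IsMonic (S k a)
  monic-S k a = monic-quotient (monic-E a) (P-S k a)
    (monic-E (k ℕ.* a) {{ℕ.m*n≢0 k a}}) (≈-trans (⊛-comm≈ (E a) (S k a)) (S-E k a))

  -- The value of a coefficient list written highest degree first.
  value : List ℤ → Series
  value []      = 0#
  value (c ∷ r) = const c ⊛ X (length r) ⊕ value r

  coeff-reverse : ∀ l → coeff (reverse l) ≈ value l
  coeff-reverse []      = pointwise λ { zero → refl ; (suc n) → refl }
  coeff-reverse (c ∷ r) = ≈.begin
    coeff (reverse (c ∷ r))
      ≈.≡⟨ cong coeff (unfold-reverse c r) ⟩
    coeff (reverse r Data.List.++ c ∷ [])
      ≈.≈⟨ coeff-++ (reverse r) (c ∷ []) ⟩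
    coeff (reverse r) ⊕ X (length (reverse r)) ⊛ coeff (c ∷ [])
      ≈.≈⟨ ⊕-cong (coeff-reverse r) (⊛-cong (X-≡ (length-reverse r))
                                         (pointwise λ { zero → refl ; (suc n) → refl })) ⟩
    value r ⊕ X (length r) ⊛ const c
      ≈.≈⟨ pointwise (λ n → ℤ.+-comm (value r n) _) ⟩
    X (length r) ⊛ const c ⊕ value r
      ≈.≈⟨ ⊕-cong (⊛-comm≈ (X (length r)) (const c)) ≈-refl ⟩
    value (c ∷ r) ≈.∎

  coeff-value : ∀ f → coeff f ≈ value (reverse f)
  coeff-value f = ≈-trans (pointwise λ n → cong (λ g → coeff g n) (sym (reverse-involutive f)))
                          (coeff-reverse (reverse f))

  vanish-value : ∀ l → VanishesFrom (length l) (value l)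
  vanish-value l n l≤n = trans (sym (at (coeff-reverse l) n))
    (vanish-coeff (reverse l) n (subst (_≤ n) (sym (length-reverse l)) l≤n))

  value-lead : ∀ c r → value (c ∷ r) (length r) ≡ c
  value-lead c r = trans (cong₂ ℤ._+_
      (trans (const-⊛ c (X (length r)) (length r))
        (trans (cong (ℤ._*_ c) (X-diag (length r))) (ℤ.*-identityʳ c)))
      (vanish-value r (length r) ℕ.≤-refl)) (ℤ.+-identityʳ c)

  value-dropZeros : ∀ l → value (dropZeros l) ≈ value l
  value-dropZeros []              = ≈-refl
  value-dropZeros (+ 0 ∷ r)       = ≈-trans (value-dropZeros r) (pointwise λ n →
    sym (trans (cong (ℤ._+ value r n)
      (trans (const-⊛ (+ 0) (X (length r)) n) (ℤ.*-zeroˡ (X (length r) n)))) (ℤ.+-identityˡ _)))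
  value-dropZeros (+ (suc n) ∷ r) = ≈-refl
  value-dropZeros (-[1+ n ] ∷ r)  = ≈-refl

  length-dropZeros : ∀ l → length (dropZeros l) ≤ length l
  length-dropZeros []              = z≤n
  length-dropZeros (+ 0 ∷ r)       = ℕ.m≤n⇒m≤1+n (length-dropZeros r)
  length-dropZeros (+ (suc n) ∷ r) = ℕ.≤-refl
  length-dropZeros (-[1+ n ] ∷ r)  = ℕ.≤-refl

  dropZeros-lead : ∀ l → dropZeros l ≡ [] ⊎ ∃ λ c → ∃ λ r → c ≢ + 0 × dropZeros l ≡ c ∷ r
  dropZeros-lead []              = inj₁ refl
  dropZeros-lead (+ 0 ∷ r)       = dropZeros-lead r
  dropZeros-lead (+ (suc n) ∷ r) = inj₂ (_ , r , (λ ()) , refl)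
  dropZeros-lead (-[1+ n ] ∷ r)  = inj₂ (_ , r , (λ ()) , refl)

  -- The first surviving entry is nonzero and sits at the index given by the length of the rest, so
  -- that index is the degree and the entry is the leading coefficient 1.
  dropZeros-monic : ∀ l → IsMonic (value l) → ∃ λ gt → dropZeros l ≡ + 1 ∷ gt
  dropZeros-monic l (m , lead , v)
    with dropZeros l | dropZeros-lead l | at (value-dropZeros l)
  ... | [] | _ | l≈ = contradiction (trans (sym lead) (trans (sym (l≈ m)) (0at m))) λ ()
    where
    0at : ∀ m → 0# m ≡ + 0
    0at zero    = refl
    0at (suc m) = refl
  ... | c ∷ r | inj₂ (_ , _ , c≢0 , refl) | l≈ with ℕ.<-cmp m (length r)
  ... | tri< m<r _ _ = contradiction
    (trans (sym (value-lead c r)) (trans (l≈ (length r)) (v (length r) m<r))) c≢0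
  ... | tri≈ _ refl _ = r , cong (_∷ r) (trans (sym (value-lead c r)) (trans (l≈ m) lead))
  ... | tri> _ _ r<m = contradiction
    (trans (sym lead) (trans (sym (l≈ m)) (vanish-value (c ∷ r) m r<m))) λ ()

  length-subPrefix : ∀ c g r → length (subPrefix c g r) ≡ length r
  length-subPrefix c []      r       = refl
  length-subPrefix c (b ∷ g) []      = refl
  length-subPrefix c (b ∷ g) (x ∷ r) = cong suc (length-subPrefix c g r)

  -- The entries of `r` are aligned with those of `g` at the high end, so the surplus length `k`
  -- becomes the factor x^k.
  value-subPrefix : ∀ c g r k → length r ≡ length g ℕ.+ k →
                    value (subPrefix c g r) ≈ value r ⊖⊖ const c ⊛ (X k ⊛ value g)
  value-subPrefix c []      r       k eq = pointwise λ n → sym (trans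
    (cong (λ a → value r n ℤ.- a) (at zero≈ n)) (ℤ.+-identityʳ _))
    where
    zero≈ : const c ⊛ (X k ⊛ 0#) ≈ λ _ → + 0
    zero≈ = pointwise λ n → trans (at (*-congˡ {const c} (⊛-comm≈ (X k) 0#)) n)
      (trans (⊛-comm (const c) _ n) (vanish-0 (0# ⊛ X k) (const c)
        (vanish-0 0# (X k) λ { zero → refl ; (suc _) → refl }) n))
  value-subPrefix c (b ∷ g) (x ∷ r) k eq = ≈.begin
    const (x ℤ.- c ℤ.* b) ⊛ X (length (subPrefix c g r)) ⊕ value (subPrefix c g r)
      ≈.≈⟨ ⊕-cong (⊛-cong const-≈ (≈-trans (X-≡ (trans (length-subPrefix c g r) eq′)) (X-+ (length g) k)))
                  (value-subPrefix c g r k eq′) ⟩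
    (const x ⊖⊖ const c ⊛ const b) ⊛ (X (length g) ⊛ X k) ⊕ (value r ⊖⊖ const c ⊛ (X k ⊛ value g))
      ≈.≈⟨ subPrefix-identity (const x) (const c) (const b) (X (length g)) (X k) (value r) (value g) ⟩
    const x ⊛ (X (length g) ⊛ X k) ⊕ value r ⊖⊖ const c ⊛ (X k ⊛ (const b ⊛ X (length g) ⊕ value g))
      ≈.≈⟨ ⊕-cong (⊕-cong (*-congˡ {const x} (≈-trans (≈-sym (X-+ (length g) k)) (X-≡ (sym eq′))))
                            ≈-refl) ≈-refl ⟩
    value (x ∷ r) ⊖⊖ const c ⊛ (X k ⊛ value (b ∷ g)) ≈.∎
    where
    eq′ = ℕ.suc-injective eq
    const-≈ : const (x ℤ.- c ℤ.* b) ≈ const x ⊖⊖ const c ⊛ const b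
    const-≈ = pointwise λ
      { zero → refl
      ; (suc n) → cong (λ a → + 0 ℤ.- a) (sym (trans (const-⊛ c (const b) (suc n)) (ℤ.*-zeroʳ c))) }

  -- Leading zeros of intermediate remainders are kept, so every step emits exactly one entry. The
  -- exact length is needed because the degree of a quotient term is determined by the number of
  -- entries after it.
  length-divH : ∀ k r gt → length r ≤ k → length (divH k r gt) ≡ length r ∸ length gt
  length-divH zero    []      gt _ = sym (ℕ.0∸n≡0 (length gt))
  length-divH (suc k) []      gt _ = sym (ℕ.0∸n≡0 (length gt))
  length-divH (suc k) (c ∷ r) gt (s≤s r≤k)
    with length r <ᵇ length gt | ℕ.<ᵇ-reflects-< (length r) (length gt)
  ... | true  | ofʸ r<g = sym (ℕ.m≤n⇒m∸n≡0 r<g)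
  ... | false | ofⁿ r≮g = begin
    suc (length (divH k (subPrefix c gt r) gt))
      ≡⟨ cong suc (length-divH k _ gt (subst (_≤ k) (sym (length-subPrefix c gt r)) r≤k)) ⟩
    suc (length (subPrefix c gt r) ∸ length gt)
      ≡⟨ cong (λ l → suc (l ∸ length gt)) (length-subPrefix c gt r) ⟩
    suc (length r ∸ length gt)
      ≡⟨ ℕ.+-∸-assoc 1 (ℕ.≮⇒≥ r≮g) ⟨
    suc (length r) ∸ length gt ∎
    where open ≡-Reasoning

  IsPoly-const : ∀ c → IsPoly (const c)
  IsPoly-const c = 1 , λ { (suc n) _ → refl }

  module _ (gt : List ℤ) where
    private
      m = length gt
      G = X m ⊕ value gt

      G-lead : G m ≡ + 1
      G-lead = cong₂ ℤ._+_ (X-diag m) (vanish-value gt m ℕ.≤-refl)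

      G-vanish : VanishesFrom (suc m) G
      G-vanish = vanish-⊕ {f = X m} {value gt} (vanish-X m)
        (vanish-≤ {f = value gt} (ℕ.n≤1+n m) (vanish-value gt))

      divides-zero : ∀ r h → length r ≤ m → IsPoly h → value r ≈ G ⊛ h → 0# ≈ h
      divides-zero r h r≤m Ph eq = pointwise λ n → trans (0at n)
        (sym (vanish-quotient {m} {0} {G} {h} G-lead G-vanish Ph
          (λ k m≤k → trans (sym (at eq k))
            (vanish-value r k (ℕ.≤-trans r≤m (ℕ.≤-trans (ℕ.m≤m+n m 0) m≤k)))) n z≤n))
        where
        0at : ∀ m → 0# m ≡ + 0
        0at zero    = refl
        0at (suc m) = refl

      divides-step : ∀ c r h k → length r ≡ m ℕ.+ k → value (c ∷ r) ≈ G ⊛ h →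
                     value (subPrefix c gt r) ≈ G ⊛ (h ⊖⊖ const c ⊛ X k)
      divides-step c r h k eq v≈ = ≈.begin
        value (subPrefix c gt r)
          ≈.≈⟨ value-subPrefix c gt r k eq ⟩
        value r ⊖⊖ const c ⊛ (X k ⊛ value gt)
          ≈.≈⟨ divStep-identity (const c) (X m) (X k) (value r) (value gt) ⟩
        const c ⊛ (X m ⊛ X k) ⊕ value r ⊖⊖ G ⊛ (const c ⊛ X k)
          ≈.≈⟨ ⊕-cong (≈-trans (⊕-cong (*-congˡ {const c} (≈-trans (≈-sym (X-+ m k)) (X-≡ (sym eq)))) ≈-refl) v≈)
                      ≈-refl ⟩
        G ⊛ h ⊖⊖ G ⊛ (const c ⊛ X k)
          ≈.≈⟨ distribˡ-- G h (const c ⊛ X k) ⟩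
        G ⊛ (h ⊖⊖ const c ⊛ X k) ≈.∎

    -- The invariant is exactness: emitting `c` at degree j leaves a multiple of the divisor with
    -- quotient h - c x^j. Each step shortens the list by one entry, so its length is enough fuel.
    value-divH : ∀ k r h → length r ≤ k → IsPoly h → value r ≈ (X m ⊕ value gt) ⊛ h →
                 value (divH k r gt) ≈ h
    value-divH zero    []      h _ Ph eq = divides-zero [] h z≤n Ph eq
    value-divH (suc k) []      h _ Ph eq = divides-zero [] h z≤n Ph eq
    value-divH (suc k) (c ∷ r) h (s≤s r≤k) Ph eq
      with length r <ᵇ length gt | ℕ.<ᵇ-reflects-< (length r) (length gt)
    ... | true  | ofʸ r<m = divides-zero (c ∷ r) h r<m Ph eq
    ... | false | ofⁿ r≮m = ≈.begin
      const c ⊛ X (length (divH k s gt)) ⊕ value (divH k s gt)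
        ≈.≈⟨ ⊕-cong (*-congˡ {const c} (X-≡ quotient-length))
               (value-divH k s (h ⊖⊖ const c ⊛ X j) s≤k Ph′ (divides-step c r h j r≡m+j eq)) ⟩
      const c ⊛ X j ⊕ (h ⊖⊖ const c ⊛ X j)
        ≈.≈⟨ cancel-+- (const c ⊛ X j) h ⟩
      h ≈.∎
      where
      s = subPrefix c gt r
      j = length r ∸ m
      r≡m+j : length r ≡ m ℕ.+ j
      r≡m+j = sym (ℕ.m+[n∸m]≡n (ℕ.≮⇒≥ r≮m))
      s≤k : length s ≤ k
      s≤k = subst (_≤ k) (sym (length-subPrefix c gt r)) r≤k
      quotient-length : length (divH k s gt) ≡ j
      quotient-length = trans (length-divH k s gt s≤k) (cong (_∸ m) (length-subPrefix c gt r))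
      Ph′ : IsPoly (h ⊖⊖ const c ⊛ X j)
      Ph′ = IsPoly-⊕ {h} Ph (IsPoly-⊖ {const c ⊛ X j}
        (IsPoly-⊛ {const c} {X j} (IsPoly-const c) (suc j , vanish-X j)))

  pdiv-correct : ∀ f g h → IsMonic (coeff g) → IsPoly h → coeff f ≈ coeff g ⊛ h →
                 coeff (pdiv f g) ≈ h
  pdiv-correct f g h mg Ph eq
    with dropZeros (reverse g) | value-dropZeros (reverse g)
       | dropZeros-monic (reverse g) (monic-resp (coeff-value g) mg)
  ... | _ | g≈ | gt , refl =
    ≈-trans (coeff-reverse (divH (length f) (dropZeros (reverse f)) gt))
      (value-divH gt (length f) (dropZeros (reverse f)) h
      (ℕ.≤-trans (length-dropZeros (reverse f)) (ℕ.≤-reflexive (length-reverse f))) Ph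
      (≈.begin
        value (dropZeros (reverse f))    ≈.≈⟨ value-dropZeros (reverse f) ⟩
        value (reverse f)                ≈.≈⟨ coeff-value f ⟨
        coeff f                          ≈.≈⟨ eq ⟩
        coeff g ⊛ h                      ≈.≈⟨ ⊛-cong (≈-trans (coeff-value g) (≈-sym g≈)) ≈-refl ⟩
        value (+ 1 ∷ gt) ⊛ h             ≈.≈⟨ ⊛-cong (⊕-cong (⊛-identityˡ≈ (X (length gt))) ≈-refl) ≈-refl ⟩
        (X (length gt) ⊕ value gt) ⊛ h   ≈.∎))

-- Lists of divisors and the recursive table of cyclotomic polynomials

module Divisors where

  open PowerSeries
  open Polynomials
  open LongDivision
  open import Data.List using (List; []; _∷_; _++_; [_]; map; foldr; filter; applyUpTo)
  open import Data.List.Properties using (map-++; applyUpTo-∷ʳ)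
  open import Data.List.Membership.Propositional using (_∈_)
  open import Data.List.Membership.Propositional.Properties
    using (∈-map⁺; ∈-map⁻; ∈-++⁺ˡ; ∈-++⁺ʳ; ∈-++⁻; ∈-filter⁺; ∈-filter⁻; ∈-applyUpTo⁺; ∈-applyUpTo⁻)
  open import Data.List.Membership.Propositional.Properties.WithK using (unique∧set⇒bag)
  open import Data.List.Relation.Binary.BagAndSetEquality using (∼bag⇒↭)
  open import Data.List.Relation.Binary.Permutation.Propositional as Perm using (_↭_)
  open import Data.List.Relation.Unary.All as All using ([]; _∷_)
  open import Data.List.Relation.Unary.AllPairs using ([]; _∷_)
  open import Data.List.Relation.Unary.Any using (here; there)
  open import Data.List.Relation.Unary.Unique.Propositional using (Unique)
  import Data.List.Relation.Unary.Unique.Propositional.Properties as Unique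
  open import Data.Nat as ℕ using (ℕ; zero; suc; NonZero; _<_; s≤s)
  open import Data.Nat.Coprimality using (Coprime; coprime-divisor)
  open import Data.Nat.Divisibility
  open import Data.Nat.Primality using (Prime; prime⇒irreducible; prime⇒nonZero)
  import Data.Nat.Properties as ℕ
  open import Data.Product using (_×_; _,_)
  open import Data.Sum using (inj₁; inj₂)
  open import Function using (_∘_; _⇔_; mk⇔; Equivalence)
  open import Relation.Binary.PropositionalEquality hiding ([_]; setoid)
  open import Relation.Nullary using (¬_; yes; no; contradiction)
  import Relation.Binary.Reasoning.Setoid setoid as ≈

  IsDivisors : ℕ → List ℕ → Set
  IsDivisors n ds = Unique ds × (∀ {d} → d ∈ ds ⇔ d ∣ n)

  divisors-1 : IsDivisors 1 (1 ∷ [])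
  divisors-1 = ([] ∷ []) , mk⇔ (λ { (here refl) → ∣-refl }) (λ d∣1 → here (∣1⇒≡1 d∣1))

  prime∤⇒coprime : ∀ {p m} → Prime p → ¬ p ∣ m → Coprime p m
  prime∤⇒coprime {p} {m} pp p∤m (d∣p , d∣m) with prime⇒irreducible pp d∣p
  ... | inj₁ d≡1  = d≡1
  ... | inj₂ refl = contradiction d∣m p∤m

  -- A divisor of pm either is p times a divisor of m or is coprime to p and divides m. The two
  -- kinds are disjoint because p does not divide m.
  divisors-prime-* : ∀ {p m ds} → Prime p → ¬ p ∣ m → IsDivisors m ds →
                     IsDivisors (p ℕ.* m) (map (p ℕ.*_) ds ++ ds)
  divisors-prime-* {p} {m} {ds} pp p∤m (unique , ∈⇔∣) =
    Unique.++⁺ (Unique.map⁺ (λ {x} {y} → ℕ.*-cancelˡ-≡ x y p {{prime⇒nonZero pp}}) unique) unique disjoint ,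
    mk⇔ sound complete
    where
    module M {d} = Equivalence (∈⇔∣ {d})
    disjoint : ∀ {d} → ¬ (d ∈ map (p ℕ.*_) ds × d ∈ ds)
    disjoint (d∈map , d∈ds) with e , _ , refl ← ∈-map⁻ (p ℕ.*_) d∈map =
      p∤m (∣-trans (m∣m*n e) (M.to d∈ds))
    sound : ∀ {d} → d ∈ map (p ℕ.*_) ds ++ ds → d ∣ p ℕ.* m
    sound d∈ with ∈-++⁻ (map (p ℕ.*_) ds) d∈
    ... | inj₁ d∈map with e , e∈ds , refl ← ∈-map⁻ (p ℕ.*_) d∈map = *-monoʳ-∣ p (M.to e∈ds)
    ... | inj₂ d∈ds = ∣n⇒∣m*n p (M.to d∈ds)
    complete : ∀ {d} → d ∣ p ℕ.* m → d ∈ map (p ℕ.*_) ds ++ ds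
    complete {d} d∣pm with p ∣? d
    ... | yes (divides e refl) = ∈-++⁺ˡ (subst (_∈ map (p ℕ.*_) ds) (ℕ.*-comm p e)
      (∈-map⁺ (p ℕ.*_) (M.from (*-cancelˡ-∣ p {{prime⇒nonZero pp}}
        (subst (_∣ p ℕ.* m) (ℕ.*-comm e p) d∣pm)))))
    ... | no p∤d = ∈-++⁺ʳ _ (M.from (coprime-divisor
      (λ { (x∣d , x∣p) → prime∤⇒coprime pp p∤d (x∣p , x∣d) }) d∣pm))

  lastPoly-++ : ∀ l d φ → lastPoly (l ++ [ (d , φ) ]) ≡ φ
  lastPoly-++ []          d φ = refl
  lastPoly-++ (_ ∷ [])    d φ = refl
  lastPoly-++ (_ ∷ x ∷ l) d φ = lastPoly-++ (x ∷ l) d φ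

  Φ-suc : ∀ k → Φ (suc k) ≡ pdiv (xnm1 (suc k)) (prodDivs (suc k) (phis k))
  Φ-suc k = lastPoly-++ (phis k) (suc k) _

  phis-map : ∀ k → phis k ≡ map (λ d → d , Φ d) (applyUpTo suc k)
  phis-map zero    = refl
  phis-map (suc k) = begin
    phis k ++ [ (suc k , pdiv (xnm1 (suc k)) (prodDivs (suc k) (phis k))) ]
      ≡⟨ cong₂ (λ l φ → l ++ [ (suc k , φ) ]) (phis-map k) (sym (Φ-suc k)) ⟩
    map (λ d → d , Φ d) (applyUpTo suc k) ++ [ (suc k , Φ (suc k)) ]
      ≡⟨ map-++ (λ d → d , Φ d) (applyUpTo suc k) (suc k ∷ []) ⟨
    map (λ d → d , Φ d) (applyUpTo suc k ++ suc k ∷ [])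
      ≡⟨ cong (map (λ d → d , Φ d)) (applyUpTo-∷ʳ suc k) ⟩
    map (λ d → d , Φ d) (applyUpTo suc (suc k)) ∎
    where open ≡-Reasoning

  ∏Φ : List ℕ → Series
  ∏Φ = foldr (λ d f → coeff (Φ d) ⊛ f) 1#

  coeff-prodDivs : ∀ n ds → coeff (prodDivs n (map (λ d → d , Φ d) ds)) ≈ ∏Φ (filter (_∣? n) ds)
  coeff-prodDivs n []       = pointwise λ { zero → refl ; (suc _) → refl }
  coeff-prodDivs n (d ∷ ds) with d ∣? n
  ... | yes _ = ≈-trans (coeff-pmul (Φ d) _) (⊛-cong {coeff (Φ d)} ≈-refl (coeff-prodDivs n ds))
  ... | no  _ = coeff-prodDivs n ds

  ∏Φ-↭ : ∀ {ds es} → ds ↭ es → ∏Φ ds ≈ ∏Φ es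
  ∏Φ-↭ Perm.refl = ≈-refl
  ∏Φ-↭ (Perm.prep d π) = ⊛-cong {coeff (Φ d)} ≈-refl (∏Φ-↭ π)
  ∏Φ-↭ (Perm.swap {ds} {es} d e π) = ≈.begin
    coeff (Φ d) ⊛ (coeff (Φ e) ⊛ ∏Φ ds)   ≈.≈⟨ ⊛-assoc≈ (coeff (Φ d)) (coeff (Φ e)) (∏Φ ds) ⟨
    (coeff (Φ d) ⊛ coeff (Φ e)) ⊛ ∏Φ ds   ≈.≈⟨ ⊛-cong (⊛-comm≈ (coeff (Φ d)) (coeff (Φ e))) (∏Φ-↭ π) ⟩
    (coeff (Φ e) ⊛ coeff (Φ d)) ⊛ ∏Φ es   ≈.≈⟨ ⊛-assoc≈ (coeff (Φ e)) (coeff (Φ d)) (∏Φ es) ⟩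
    coeff (Φ e) ⊛ (coeff (Φ d) ⊛ ∏Φ es)   ≈.∎
  ∏Φ-↭ (Perm.trans π ρ) = ≈-trans (∏Φ-↭ π) (∏Φ-↭ ρ)

  -- The table meets the divisors in increasing order, the explicit lists are ordered by their prime
  -- factors. Both are free of duplicates and have the same members, hence are permutations of each
  -- other.
  properDivisors-↭ : ∀ k {ds} → IsDivisors (suc k) (suc k ∷ ds) →
                     filter (_∣? suc k) (applyUpTo suc k) ↭ ds
  properDivisors-↭ k {ds} (n∉ds ∷ unique , ∈⇔∣) = ∼bag⇒↭ (unique∧set⇒bag
    (Unique.filter⁺ (_∣? suc k)
      (Unique.applyUpTo⁺₁ suc k λ i<j _ → ℕ.<⇒≢ i<j ∘ ℕ.suc-injective))
    unique (mk⇔ to from))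
    where
    to : ∀ {d} → d ∈ filter (_∣? suc k) (applyUpTo suc k) → d ∈ ds
    to d∈ with d∈range , d∣n ← ∈-filter⁻ (_∣? suc k) {xs = applyUpTo suc k} d∈ with Equivalence.from ∈⇔∣ d∣n
    ... | there d∈ds = d∈ds
    ... | here refl with i , i<k , eq ← ∈-applyUpTo⁻ suc d∈range =
      contradiction (ℕ.suc-injective (sym eq)) (ℕ.<⇒≢ i<k)
    from : ∀ {d} → d ∈ ds → d ∈ filter (_∣? suc k) (applyUpTo suc k)
    from {d} d∈ds = ∈-filter⁺ (_∣? suc k) (range d d∣n d<n) d∣n
      where
      d∣n : d ∣ suc k
      d∣n = Equivalence.to ∈⇔∣ (there d∈ds)
      d<n : d < suc k
      d<n = ℕ.≤∧≢⇒< (∣⇒≤ d∣n) λ d≡n → All.lookup n∉ds d∈ds (sym d≡n)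
      range : ∀ d → d ∣ suc k → d < suc k → d ∈ applyUpTo suc k
      range zero    0∣n _         = contradiction (0∣⇒≡0 0∣n) λ ()
      range (suc i) _   (s≤s i<k) = ∈-applyUpTo⁺ suc i<k

  module _ {n ds W} .{{_ : NonZero n}} (div : IsDivisors n (n ∷ ds)) (PW : IsPoly W)
           (eq : ∏Φ ds ⊛ W ≈ E n) where

    -- Reduces the computation of Φ_n to exhibiting one polynomial `W` that completes the product
    -- over the proper divisors to xⁿ - 1.
    Φ-quotient : IsMonic (∏Φ ds) → coeff (Φ n) ≈ W
    Φ-quotient monic = go n div eq
      where
      go : ∀ n .{{_ : NonZero n}} → IsDivisors n (n ∷ ds) → ∏Φ ds ⊛ W ≈ E n → coeff (Φ n) ≈ W
      go (suc k) div eq = ≈-trans (pointwise λ i → cong (λ f → coeff f i) (Φ-suc k))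
        (pdiv-correct (xnm1 (suc k)) (prodDivs (suc k) (phis k)) W
          (monic-resp (≈-sym prod≈) monic) PW
          (≈-trans (coeff-xnm1 (suc k)) (≈-trans (≈-sym eq) (⊛-cong (≈-sym prod≈) ≈-refl))))
        where
        prod≈ : coeff (prodDivs (suc k) (phis k)) ≈ ∏Φ ds
        prod≈ = ≈-trans (pointwise λ i → cong (λ l → coeff (prodDivs (suc k) l) i) (phis-map k))
          (≈-trans (coeff-prodDivs (suc k) (applyUpTo suc k)) (∏Φ-↭ (properDivisors-↭ k div)))

    monic-Φ : IsMonic (∏Φ ds) → IsMonic W
    monic-Φ monic = monic-quotient {h = W} monic PW (monic-E n) eq

    -- The same factorisation read the other way: Φ_n is monic as a quotient of monic polynomials,
    -- so dividing by it returns the product over the proper divisors.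
    Ψ-quotient : IsMonic (∏Φ ds) → coeff (Ψ n) ≈ ∏Φ ds
    Ψ-quotient monic@(m , _ , v) = pdiv-correct (xnm1 n) (Φ n) (∏Φ ds)
      (monic-resp (≈-sym Φ≈) (monic-Φ monic)) (suc m , v)
      (≈-trans (coeff-xnm1 n) (≈-trans (≈-sym eq)
        (≈-trans (⊛-comm≈ (∏Φ ds) W) (⊛-cong (≈-sym Φ≈) ≈-refl))))
      where
      Φ≈ = Φ-quotient monic

-- Cyclotomic polynomials for one and two primes, and the factorisation of Ψ_pqr

module Cyclotomic where

  open PowerSeries
  open Polynomials
  open LongDivision
  open Divisors
  open import Data.List using (List; []; _∷_)
  open import Data.Nat as ℕ using (ℕ; suc; NonZero)
  open import Data.Nat.Coprimality using (Coprime)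
  open import Data.Nat.Divisibility using (_∣_; ∣1⇒≡1)
  open import Data.Nat.Primality
    using (Prime; prime⇒irreducible; prime⇒nonZero; ¬prime[1]; euclidsLemma)
  import Data.Nat.Properties as ℕ
  open import Data.Product using (_,_; proj₁; proj₂)
  open import Data.Sum using (inj₁; inj₂; [_,_]′)
  open import Relation.Binary.PropositionalEquality hiding ([_]; setoid)
  open import Relation.Nullary using (¬_)

  -- The lists of divisors contain unreduced products such as `a * 1`.
  Φ-≡ : ∀ {m n} → m ≡ n → coeff (Φ m) ≈ coeff (Φ n)
  Φ-≡ refl = ≈-refl

  monic-1 : IsMonic 1#
  monic-1 = 0 , refl , λ { (suc n) _ → refl }

  Φ-1 : coeff (Φ 1) ≈ E 1
  Φ-1 = Φ-quotient {1} {[]} {E 1} divisors-1 (P-E 1) (⊛-identityˡ≈ (E 1)) monic-1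

  prime∤1 : ∀ {a} → Prime a → ¬ a ∣ 1
  prime∤1 pa a∣1 = ¬prime[1] (subst Prime (∣1⇒≡1 a∣1) pa)

  prime∤prime : ∀ {a b} → Prime a → Prime b → a ≢ b → ¬ a ∣ b
  prime∤prime pa pb a≢b a∣b with prime⇒irreducible pb a∣b
  ... | inj₁ a≡1 = ¬prime[1] (subst Prime a≡1 pa)
  ... | inj₂ a≡b = a≢b a≡b

  divisors-prime : ∀ {a} → Prime a → IsDivisors a (a ∷ 1 ∷ [])
  divisors-prime {a} pa = subst (λ n → IsDivisors n (n ∷ 1 ∷ [])) (ℕ.*-identityʳ a)
    (divisors-prime-* pa (prime∤1 pa) divisors-1)

  ∏Φ-1 : ∏Φ (1 ∷ []) ≈ E 1 ⊛ 1#
  ∏Φ-1 = ⊛-cong Φ-1 ≈-refl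

  monic-E1 : IsMonic (E 1 ⊛ 1#)
  monic-E1 = monic-⊛ {E 1} {1#} (monic-E 1) monic-1

  Φ-prime : ∀ {a} → Prime a → coeff (Φ a) ≈ S a 1
  Φ-prime {a} pa = Φ-quotient {ds = 1 ∷ []} {S a 1} {{prime⇒nonZero pa}} (divisors-prime pa) (P-S a 1)
    (≈-trans (⊛-cong ∏Φ-1 (≈-refl {S a 1})) (properProduct₁ a)) (monic-resp (≈-sym ∏Φ-1) monic-E1)

  module _ {a b} (pa : Prime a) (pb : Prime b) (a≢b : a ≢ b) where
    private
      instance
        _ = prime⇒nonZero pa
        _ = prime⇒nonZero pb

    primes-coprime : Coprime a b
    primes-coprime = prime∤⇒coprime pa (prime∤prime pa pb a≢b)

    Φ₂ : Series
    Φ₂ = proj₁ (Φ₂-exists a b primes-coprime)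

    Φ₂-eq : E a ⊛ E b ⊛ Φ₂ ≈ E (a ℕ.* b) ⊛ E 1
    Φ₂-eq = proj₂ (proj₂ (Φ₂-exists a b primes-coprime))

    P-Φ₂ : IsPoly Φ₂
    P-Φ₂ = proj₁ (proj₂ (Φ₂-exists a b primes-coprime))

    divisors-prime² : IsDivisors (a ℕ.* b) (a ℕ.* b ∷ a ℕ.* 1 ∷ b ∷ 1 ∷ [])
    divisors-prime² = divisors-prime-* pa (prime∤prime pa pb a≢b) (divisors-prime pb)

    private
      ab≢0 : NonZero (a ℕ.* b)
      ab≢0 = ℕ.m*n≢0 a b

    ∏Φ-prime² : ∏Φ (a ℕ.* 1 ∷ b ∷ 1 ∷ []) ≈ S a 1 ⊛ (S b 1 ⊛ (E 1 ⊛ 1#))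
    ∏Φ-prime² = ⊛-cong (≈-trans (Φ-≡ (ℕ.*-identityʳ a)) (Φ-prime pa)) (⊛-cong (Φ-prime pb) ∏Φ-1)

    monic-prime² : IsMonic (S a 1 ⊛ (S b 1 ⊛ (E 1 ⊛ 1#)))
    monic-prime² = monic-⊛ {S a 1} {S b 1 ⊛ (E 1 ⊛ 1#)} (monic-S a 1)
      (monic-⊛ {S b 1} {E 1 ⊛ 1#} (monic-S b 1) monic-E1)

    private
      quotient : ∏Φ (a ℕ.* 1 ∷ b ∷ 1 ∷ []) ⊛ Φ₂ ≈ E (a ℕ.* b)
      quotient = ≈-trans (⊛-cong ∏Φ-prime² (≈-refl {Φ₂})) (properProduct₂ a b Φ₂ Φ₂-eq)

    Φ-prime² : coeff (Φ (a ℕ.* b)) ≈ Φ₂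
    Φ-prime² = Φ-quotient {{ab≢0}} divisors-prime² P-Φ₂ quotient
      (monic-resp (≈-sym ∏Φ-prime²) monic-prime²)

    monic-Φ₂ : IsMonic Φ₂
    monic-Φ₂ = monic-Φ {{ab≢0}} divisors-prime² P-Φ₂ quotient
      (monic-resp (≈-sym ∏Φ-prime²) monic-prime²)

  module _ {p q r} (pp : Prime p) (pq : Prime q) (pr : Prime r)
           (p≢q : p ≢ q) (p≢r : p ≢ r) (q≢r : q ≢ r) where
    private
      instance
        _ = prime⇒nonZero pp
        _ = prime⇒nonZero pq
        _ = prime⇒nonZero pr
        _ = ℕ.m*n≢0 q r
        _ = ℕ.m*n≢0 p (q ℕ.* r)
      Fpq = Φ₂ pp pq p≢q
      Fpr = Φ₂ pp pr p≢r
      Fqr = Φ₂ pq pr q≢r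

      r⊥pq : Coprime r (p ℕ.* q)
      r⊥pq = prime∤⇒coprime pr λ r∣pq →
        [ prime∤prime pr pp (≢-sym p≢r) , prime∤prime pr pq (≢-sym q≢r) ]′ (euclidsLemma p q pr r∣pq)

      p∤qr : ¬ p ∣ q ℕ.* r
      p∤qr p∣qr = [ prime∤prime pp pq p≢q , prime∤prime pp pr p≢r ]′ (euclidsLemma q r pp p∣qr)

      Φ₃ = Φ₃-exists p q r (λ p≡1 → ¬prime[1] (subst Prime p≡1 pp)) (primes-coprime pp pq p≢q) r⊥pq
                     Fpq (Φ₂-eq pp pq p≢q)

      -- p times the divisors of qr, without pqr itself, followed by the divisors of qr.
      D : List ℕ
      D = p ℕ.* (q ℕ.* 1) ∷ p ℕ.* r ∷ p ℕ.* 1 ∷ q ℕ.* r ∷ q ℕ.* 1 ∷ r ∷ 1 ∷ []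

      divisors : IsDivisors (p ℕ.* (q ℕ.* r)) (p ℕ.* (q ℕ.* r) ∷ D)
      divisors = divisors-prime-* pp p∤qr (divisors-prime² pq pr q≢r)

      Q = S q 1 ⊛ (S r 1 ⊛ (E 1 ⊛ 1#))

      ∏Φ-D : ∏Φ D ≈ Fpq ⊛ (Fpr ⊛ (S p 1 ⊛ (Fqr ⊛ Q)))
      ∏Φ-D = ⊛-cong (≈-trans (Φ-≡ (cong (p ℕ.*_) (ℕ.*-identityʳ q))) (Φ-prime² pp pq p≢q))
        (⊛-cong (Φ-prime² pp pr p≢r)
        (⊛-cong (≈-trans (Φ-≡ (ℕ.*-identityʳ p)) (Φ-prime pp))
        (⊛-cong (Φ-prime² pq pr q≢r) (∏Φ-prime² pq pr q≢r))))

      monic-D : IsMonic (Fpq ⊛ (Fpr ⊛ (S p 1 ⊛ (Fqr ⊛ Q))))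
      monic-D =
        monic-⊛ {Fpq} {Fpr ⊛ (S p 1 ⊛ (Fqr ⊛ Q))} (monic-Φ₂ pp pq p≢q)
        (monic-⊛ {Fpr} {S p 1 ⊛ (Fqr ⊛ Q)} (monic-Φ₂ pp pr p≢r)
        (monic-⊛ {S p 1} {Fqr ⊛ Q} (monic-S p 1)
        (monic-⊛ {Fqr} {Q} (monic-Φ₂ pq pr q≢r) (monic-prime² pq pr q≢r))))

      ∏Φ-D′ : ∏Φ D ≈ E (q ℕ.* r) ⊛ S p r ⊛ Fpq
      ∏Φ-D′ = ≈-trans ∏Φ-D (properProduct₃ p q r Fpq Fpr Fqr
        (Φ₂-eq pp pr p≢r) (Φ₂-eq pq pr q≢r))

    Ψ-prime³ : coeff (Ψ (p ℕ.* (q ℕ.* r))) ≈ E (q ℕ.* r) ⊛ S p r ⊛ Fpq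
    Ψ-prime³ = ≈-trans (Ψ-quotient {W = proj₁ Φ₃} divisors (proj₁ (proj₂ Φ₃))
        (≈-trans (⊛-cong ∏Φ-D′ ≈-refl) (proj₂ (proj₂ Φ₃)))
        (monic-resp (≈-sym ∏Φ-D) monic-D))
      ∏Φ-D′

-- Bounds for coefficients of products of geometric sums

module Bounds where

  open PowerSeries
  open Polynomials
  open LongDivision
  open import Data.Integer as ℤ using (+_; ∣_∣)
  import Data.Integer.Properties as ℤ
  open import Data.List using ([]; _∷_)
  open import Data.Nat as ℕ using (ℕ; zero; suc; NonZero; _≤_; _<_; _⊔_; _⊓_; z≤n; s≤s)
  open import Data.Nat.Coprimality using (Coprime; coprime-divisor)
  open import Data.Nat.Divisibility using (_∣_; divides; ∣m+n∣m⇒∣n; ∣⇒≤)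
  import Data.Nat.Properties as ℕ
  open import Data.Product using (∃; _×_; _,_)
  open import Data.Sum using (_⊎_; inj₁; inj₂)
  open import Relation.Binary.PropositionalEquality hiding ([_]; setoid)
  open import Relation.Nullary using (yes; no; contradiction)

  height-≤ : ∀ f {M} → (∀ n → ∣ coeff f n ∣ ≤ M) → height f ≤ M
  height-≤ []      b = z≤n
  height-≤ (a ∷ f) b = ℕ.⊔-lub (b 0) (height-≤ f λ n → b (suc n))

  -- Nonnegativity is part of the bound, so that a difference of two such series is bounded by the
  -- maximum of the bounds and not only by their sum.
  Within : ℕ → Series → Set
  Within M f = ∀ n → ∃ λ k → f n ≡ + k × k ≤ M

  within-resp : ∀ {M f g} → f ≈ g → Within M f → Within M g
  within-resp f≈g b n = let k , eq , k≤M = b n in k , trans (sym (at f≈g n)) eq , k≤M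

  within-⊓ : ∀ {M N f} → Within M f → Within N f → Within (M ⊓ N) f
  within-⊓ {N = N} b c n with b n | c n
  ... | k , eq , k≤M | l , eq′ , l≤N =
    k , eq , ℕ.⊓-glb k≤M (subst (_≤ N) (ℤ.+-injective (trans (sym eq′) eq)) l≤N)

  within-⊕ : ∀ {M N f g} → Within M f → Within N g → Within (M ℕ.+ N) (f ⊕ g)
  within-⊕ b c n with b n | c n
  ... | k , eq , k≤M | l , eq′ , l≤N = k ℕ.+ l , cong₂ ℤ._+_ eq eq′ , ℕ.+-mono-≤ k≤M l≤N

  within-X⊛ : ∀ {M f} n → Within M f → Within M (X n ⊛ f)
  within-X⊛ {f = f} n b t with position n t
  ... | below t<n = 0 , X-⊛-< n f t<n , z≤n
  ... | above k   = let j , eq , j≤M = b k in j , trans (X-⊛-≥ n f k) eq , j≤M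

  within-S⊛ : ∀ {M f} k a → Within M f → Within (k ℕ.* M) (S k a ⊛ f)
  within-S⊛ {M} {f} zero    a b n = 0 , vanish-0 0# f (λ { zero → refl ; (suc _) → refl }) n , z≤n
  within-S⊛ {M} {f} (suc k) a b = subst (λ N → Within N (S (suc k) a ⊛ f)) (ℕ.+-comm (k ℕ.* M) M)
    (within-resp (≈-sym (distribʳ≈ f (S k a) (X (k ℕ.* a))))
      (within-⊕ {f = S k a ⊛ f} {X (k ℕ.* a) ⊛ f} (within-S⊛ k a b) (within-X⊛ (k ℕ.* a) b)))

  module _ (m n : ℕ) .{{_ : NonZero m}} (m⊥n : Coprime m n) where

    S-support : ∀ a t → S a m t ≡ + 0 ⊎ S a m t ≡ + 1 × ∃ λ i → i < a × t ≡ i ℕ.* m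
    S-support zero    zero    = inj₁ refl
    S-support zero    (suc t) = inj₁ refl
    S-support (suc a) t with S-support a t | a ℕ.* m ℕ.≟ t
    ... | inj₁ z | no  am≢t = inj₁ (cong₂ ℤ._+_ z (X-off (a ℕ.* m) t am≢t))
    ... | inj₁ z | yes refl = inj₂ (cong₂ ℤ._+_ z (X-diag (a ℕ.* m)) , a , ℕ.n<1+n a , refl)
    ... | inj₂ (o , i , i<a , refl) | no  am≢t =
      inj₂ (cong₂ ℤ._+_ o (X-off (a ℕ.* m) (i ℕ.* m) am≢t) , i , ℕ.m≤n⇒m≤1+n i<a , refl)
    ... | inj₂ (o , i , i<a , refl) | yes am≡im =
      contradiction (ℕ.*-cancelʳ-≡ a i m am≡im) (≢-sym (ℕ.<⇒≢ i<a))

    -- Equality would make m divide n(b - k), hence b - k by coprimality, although 0 < b - k < m.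
    unique-representation : ∀ {k b} i i′ → k < b → b < m → k ℕ.* n ℕ.+ i′ ℕ.* m ≢ b ℕ.* n ℕ.+ i ℕ.* m
    unique-representation {k} {b} i i′ k<b b<m eq = ℕ.<⇒≱ (ℕ.≤-<-trans (ℕ.m∸n≤m b k) b<m)
      (∣⇒≤ {{ℕ.>-nonZero (ℕ.m<n⇒0<n∸m k<b)}} (coprime-divisor m⊥n m∣ne))
      where
      e = b ℕ.∸ k
      split : b ℕ.* n ≡ k ℕ.* n ℕ.+ n ℕ.* e
      split = trans (cong (ℕ._* n) (sym (ℕ.m+[n∸m]≡n (ℕ.<⇒≤ k<b))))
        (trans (ℕ.*-distribʳ-+ n k e) (cong (k ℕ.* n ℕ.+_) (ℕ.*-comm e n)))
      m∣ne : m ∣ n ℕ.* e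
      m∣ne = ∣m+n∣m⇒∣n (divides i′ (trans (ℕ.+-comm (i ℕ.* m) (n ℕ.* e)) (ℕ.+-cancelˡ-≡ (k ℕ.* n) _ _
        (trans (sym (ℕ.+-assoc (k ℕ.* n) (n ℕ.* e) (i ℕ.* m)))
          (trans (cong (ℕ._+ i ℕ.* m) (sym split)) (sym eq)))))) (divides i refl)

    -- The induction on `b` has to remember the shape of the exponents reached so far: a new
    -- exponent bn + im coincides with none of them as long as b < m. The number `a` of terms in x^m
    -- is arbitrary.
    SS-support : ∀ a b → b ≤ m → ∀ t → (S b n ⊛ S a m) t ≡ + 0 ⊎
                 (S b n ⊛ S a m) t ≡ + 1 × ∃ λ k → ∃ λ i → k < b × t ≡ k ℕ.* n ℕ.+ i ℕ.* m
    SS-support a zero    _   t = inj₁ (vanish-0 0# (S a m) (λ { zero → refl ; (suc _) → refl }) t)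
    SS-support a (suc b) b<m t = go t (SS-support a b (ℕ.<⇒≤ b<m) t) (position (b ℕ.* n) t)
      where
      expand : ∀ t {u v} → (S b n ⊛ S a m) t ≡ u → (X (b ℕ.* n) ⊛ S a m) t ≡ v →
               (S (suc b) n ⊛ S a m) t ≡ u ℤ.+ v
      expand t eq eq′ = trans (⊛-distribʳ (S a m) (S b n) (X (b ℕ.* n)) t) (cong₂ ℤ._+_ eq eq′)
      weaken : ∀ {t} → ∃ (λ k → ∃ λ i → k < b × t ≡ k ℕ.* n ℕ.+ i ℕ.* m) →
               ∃ λ k → ∃ λ i → k < suc b × t ≡ k ℕ.* n ℕ.+ i ℕ.* m
      weaken (k , i , k<b , eq) = k , i , ℕ.m≤n⇒m≤1+n k<b , eq
      go : ∀ t → (S b n ⊛ S a m) t ≡ + 0 ⊎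
                 (S b n ⊛ S a m) t ≡ + 1 × ∃ (λ k → ∃ λ i → k < b × t ≡ k ℕ.* n ℕ.+ i ℕ.* m) →
           Position (b ℕ.* n) t → (S (suc b) n ⊛ S a m) t ≡ + 0 ⊎
             (S (suc b) n ⊛ S a m) t ≡ + 1 × ∃ λ k → ∃ λ i → k < suc b × t ≡ k ℕ.* n ℕ.+ i ℕ.* m
      go t (inj₁ z)       (below t<) = inj₁ (expand t z (X-⊛-< (b ℕ.* n) (S a m) t<))
      go t (inj₂ (o , w)) (below t<) = inj₂ (expand t o (X-⊛-< (b ℕ.* n) (S a m) t<) , weaken w)
      go _ s              (above u) with S-support a u | X-⊛-≥ (b ℕ.* n) (S a m) u
      go _ (inj₁ z)       (above u) | inj₁ z′ | eq = inj₁ (expand (b ℕ.* n ℕ.+ u) z (trans eq z′))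
      go _ (inj₂ (o , w)) (above u) | inj₁ z′ | eq = inj₂ (expand (b ℕ.* n ℕ.+ u) o (trans eq z′) , weaken w)
      go _ (inj₁ z)       (above _) | inj₂ (o′ , i , _ , refl) | eq =
        inj₂ (expand (b ℕ.* n ℕ.+ i ℕ.* m) z (trans eq o′) , b , i , ℕ.n<1+n b , refl)
      -- The only case in which a coefficient 2 could arise.
      go _ (inj₂ (_ , k , i′ , k<b , eq′)) (above _) | inj₂ (_ , i , _ , refl) | _ =
        contradiction (sym eq′) (unique-representation i i′ k<b b<m)

    within-SS : ∀ a b → b ≤ m → Within 1 (S b n ⊛ S a m)
    within-SS a b b≤m t with SS-support a b b≤m t
    ... | inj₁ z       = 0 , z , z≤n
    ... | inj₂ (o , _) = 1 , o , s≤s z≤n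

  ∣-∣-within : ∀ {M N f g} → Within M f → Within N g → ∀ t → ∣ f t ℤ.- g t ∣ ≤ M ⊔ N
  ∣-∣-within b c t with b t | c t
  ... | k , eq , k≤M | l , eq′ , l≤N rewrite eq | eq′ | ℤ.m-n≡m⊖n k l =
    ℕ.≤-trans (ℤ.∣m⊝n∣≤m⊔n k l) (ℕ.⊔-mono-≤ k≤M l≤N)

  -- The copies xⁿ T and -T do not overlap, since `T` ends before degree n.
  ∣E⊛∣-≤ : ∀ {M} n T → VanishesFrom n T → (∀ t → ∣ T t ∣ ≤ M) → ∀ t → ∣ (E n ⊛ T) t ∣ ≤ M
  ∣E⊛∣-≤ {M} n T v b t = subst (λ a → ∣ a ∣ ≤ M) (sym (expand t)) (go t (position n t))
    where
    expand : ∀ t → (E n ⊛ T) t ≡ (X n ⊛ T) t ℤ.- T t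
    expand t = at (≈-trans (⊛-comm≈ (E n) T) (≈-trans (*-E T n) ≈-refl)) t
    go : ∀ t → Position n t → ∣ (X n ⊛ T) t ℤ.- T t ∣ ≤ M
    go t (below t<n) rewrite X-⊛-< n T t<n | ℤ.+-identityˡ (ℤ.- T t) | ℤ.∣-i∣≡∣i∣ (T t) = b t
    go _ (above k) rewrite X-⊛-≥ n T k | v (n ℕ.+ k) (ℕ.m≤m+n n k) | ℤ.+-identityʳ (T k) = b k

-- Arithmetic of ρ, σ and τ, and the height of Ψ_pqr

open PowerSeries
open Polynomials
open LongDivision
open Cyclotomic
open Bounds
open import Data.Integer using (+_; ∣_∣)
open import Data.Nat as ℕ using (ℕ; suc; NonZero; _+_; _*_; _∸_; _≤_; _<_; _⊔_; _⊓_)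
open import Data.Nat.Coprimality using (Coprime)
open import Data.Nat.Primality using (Prime; prime⇒nonZero)
import Data.Nat.Properties as ℕ
open import Data.Nat.Solver using (module +-*-Solver)
open import Data.Product using (_×_; _,_; proj₁; proj₂)
open import Relation.Binary.PropositionalEquality hiding ([_]; setoid)
open +-*-Solver

-- From ρp ≤ (p - 1)(q - 1) ≤ p(q - 1) one gets ρ ≤ q - 1, so the truncated subtraction is a true
-- one. The same lemma with p and q exchanged serves σ.
ρ+1-complement : ∀ p q ρ σ .{{_ : NonZero p}} .{{_ : NonZero q}} →
                 (p ∸ 1) * (q ∸ 1) ≡ ρ * p + σ * q → ρ + 1 + (q ∸ 1 ∸ ρ) ≡ q
ρ+1-complement p@(suc p′) (suc q′) ρ σ eq = trans (cong (_+ (q′ ∸ ρ)) (ℕ.+-comm ρ 1))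
  (cong suc (ℕ.m+[n∸m]≡n (ℕ.*-cancelˡ-≤ p (begin
    p * ρ              ≡⟨ ℕ.*-comm p ρ ⟩
    ρ * p              ≤⟨ ℕ.m≤m+n (ρ * p) _ ⟩
    ρ * p + σ * suc q′ ≡⟨ eq ⟨
    p′ * q′            ≤⟨ ℕ.m≤n+m (p′ * q′) q′ ⟩
    p * q′             ∎))))
  where open ℕ.≤-Reasoning

exponent-sum : ∀ p q ρ σ .{{_ : NonZero p}} .{{_ : NonZero q}} →
               (p ∸ 1) * (q ∸ 1) ≡ ρ * p + σ * q → (ρ + 1) * p + (σ + 1) * q ≡ p * q + 1
exponent-sum p@(suc p′) q@(suc q′) ρ σ eq = begin
  (ρ + 1) * p + (σ + 1) * q
    ≡⟨ solve 4 (λ ρ σ p q → (ρ :+ con 1) :* p :+ (σ :+ con 1) :* q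
                          := (ρ :* p :+ σ :* q) :+ (p :+ q)) refl ρ σ p q ⟩
  ρ * p + σ * q + (p + q)
    ≡⟨ cong (_+ (p + q)) eq ⟨
  p′ * q′ + (p + q)
    ≡⟨ solve 2 (λ p q → p :* q :+ ((con 1 :+ p) :+ (con 1 :+ q))
                      := (con 1 :+ p) :* (con 1 :+ q) :+ con 1) refl p′ q′ ⟩
  p * q + 1 ∎
  where open ≡-Reasoning

-- τ = (pq + 1 + pr) - (p + q + r): the degree of the numerator minus that of the denominator of T,
-- stated additively to avoid truncated subtraction.
degree-bound : ∀ p q r .{{_ : NonZero p}} .{{_ : NonZero q}} → (p ∸ 1) * (q + r ∸ 1) < q * r →
               suc (p * q + 1 + p * r) ≤ p + q + r + q * r
degree-bound (suc p) (suc q) r τ<qr = begin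
  suc (suc p * suc q + 1 + suc p * r)
    ≡⟨ solve 3 (λ p q r → con 1 :+ ((con 1 :+ p) :* (con 1 :+ q) :+ con 1 :+ (con 1 :+ p) :* r)
        := (con 1 :+ p) :+ (con 1 :+ q) :+ r :+ (con 1 :+ p :* (q :+ r))) refl p q r ⟩
  suc p + suc q + r + suc (p * (q + r))
    ≤⟨ ℕ.+-monoʳ-≤ (suc p + suc q + r) τ<qr ⟩
  suc p + suc q + r + suc q * r ∎
  where open ℕ.≤-Reasoning

module _ (p q r : ℕ) .{{_ : NonZero p}} .{{_ : NonZero q}} .{{_ : NonZero r}} where

  vanish-SF : ∀ {F} → IsPoly F → E p ⊛ E q ⊛ F ≈ E (p * q) ⊛ E 1 →
              (p ∸ 1) * (q + r ∸ 1) < q * r → VanishesFrom (q * r) (S p r ⊛ F)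
  vanish-SF {F} PF F-eq τ<qr = vanish-quotient {p + q + r} {q * r} {E p ⊛ E q ⊛ E r} {S p r ⊛ F}
    (proj₁ EEE) (proj₂ EEE) (IsPoly-⊛ {S p r} {F} (P-S p r) PF)
    λ n n≥ → trans (at (EEE*SF p q r F F-eq) n)
      (proj₂ numerator n (ℕ.≤-trans (degree-bound p q r τ<qr) n≥))
    where
    EEE : MonicOfDegree (p + q + r) (E p ⊛ E q ⊛ E r)
    EEE = degree-⊛ {f = E p ⊛ E q} {E r} (degree-⊛ {f = E p} {E q} (degree-E p) (degree-E q)) (degree-E r)
    numerator : MonicOfDegree (p * q + 1 + p * r) (E (p * q) ⊛ E 1 ⊛ E (p * r))
    numerator = degree-⊛ {f = E (p * q) ⊛ E 1} {E (p * r)}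
      (degree-⊛ {f = E (p * q)} {E 1} (degree-E (p * q) {{ℕ.m*n≢0 p q}}) (degree-E 1))
      (degree-E (p * r) {{ℕ.m*n≢0 p r}})

  module _ (p≤q : p ≤ q) (p⊥r : Coprime p r) (q⊥r : Coprime q r) where

    -- The p terms in xʳ can be paired with the sum in x^q, as p ≤ q, or with the sum in x^p. Either
    -- pair has coefficients 0 and 1, and the remaining sum multiplies the bound by its number of
    -- terms, a or b.
    within-SSS : ∀ a b → Within (a ⊓ b) (S a p ⊛ (S p r ⊛ S b q))
    within-SSS a b = within-⊓ {f = S a p ⊛ (S p r ⊛ S b q)}
      (subst (λ M → Within M (S a p ⊛ (S p r ⊛ S b q))) (ℕ.*-identityʳ a)
        (within-S⊛ a p (within-SS q r q⊥r b p p≤q)))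
      (subst (λ M → Within M (S a p ⊛ (S p r ⊛ S b q))) (ℕ.*-identityʳ b)
        (within-resp (exchange (S b q) (S p r) (S a p))
          (within-S⊛ b q (within-SS p r p⊥r a p ℕ.≤-refl))))

    ∣SF∣-≤ : ∀ {F} a b c d → a + c ≡ q → b + d ≡ p → a * p + b * q ≡ p * q + 1 →
             E p ⊛ E q ⊛ F ≈ E (p * q) ⊛ E 1 → ∀ t → ∣ (S p r ⊛ F) t ∣ ≤ (a ⊓ b) ⊔ (c ⊓ d)
    ∣SF∣-≤ {F} a b c d a+c b+d ab F-eq t = subst (λ z → ∣ z ∣ ≤ (a ⊓ b) ⊔ (c ⊓ d)) (sym (at SF≈ t))
      (∣-∣-within {f = S a p ⊛ (S p r ⊛ S b q)} {X 1 ⊛ (S c p ⊛ (S p r ⊛ S d q))}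
        (within-SSS a b) (within-X⊛ 1 (within-SSS c d)) t)
      where
      SF≈ : S p r ⊛ F ≈ S a p ⊛ (S p r ⊛ S b q) ⊖⊖ X 1 ⊛ (S c p ⊛ (S p r ⊛ S d q))
      SF≈ = ≈-trans (⊛-cong (≈-refl {S p r}) (lamLeung p q a b c d a+c b+d ab F F-eq))
        (distribute (S p r) (S a p) (S b q) (X 1) (S c p) (S d q))

theorem7 : (p q r : ℕ) → Prime p → Prime q → Prime r → 2 < p → p < q → q < r →
    (ρ σ : ℕ) → (p ∸ 1) * (q ∸ 1) ≡ ρ * p + σ * q →
    (p ∸ 1) * (q + r ∸ 1) < q * r →
    height (Ψ (p * q * r)) ≤ ((ρ + 1) ⊓ (σ + 1)) ⊔ ((q ∸ 1 ∸ ρ) ⊓ (p ∸ 1 ∸ σ))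
theorem7 p q r pp pq pr _ p<q q<r ρ σ eq τ<qr =
  -- The divisors of pqr were built as p times those of qr, hence the regrouping to `p * (q * r)`.
  subst (λ n → height (Ψ n) ≤ M) (sym (ℕ.*-assoc p q r)) (height-≤ (Ψ (p * (q * r))) λ n →
    subst (λ z → ∣ z ∣ ≤ M) (sym (at Ψ≈ n)) (∣E⊛∣-≤ (q * r) (S p r ⊛ F)
      (vanish-SF p q r (P-Φ₂ pp pq p≢q) F-eq τ<qr)
      (∣SF∣-≤ p q r (ℕ.<⇒≤ p<q) (primes-coprime pp pr p≢r) (primes-coprime pq pr q≢r)
        (ρ + 1) (σ + 1) (q ∸ 1 ∸ ρ) (p ∸ 1 ∸ σ)
        (ρ+1-complement p q ρ σ eq)
        (ρ+1-complement q p σ ρ (trans (ℕ.*-comm (q ∸ 1) (p ∸ 1)) (trans eq (ℕ.+-comm (ρ * p) (σ * q)))))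
        (exponent-sum p q ρ σ eq) F-eq) n))
  where
  instance
    _ = prime⇒nonZero pp
    _ = prime⇒nonZero pq
    _ = prime⇒nonZero pr
  p≢q = ℕ.<⇒≢ p<q
  p≢r = ℕ.<⇒≢ (ℕ.<-trans p<q q<r)
  q≢r = ℕ.<⇒≢ q<r
  M = ((ρ + 1) ⊓ (σ + 1)) ⊔ ((q ∸ 1 ∸ ρ) ⊓ (p ∸ 1 ∸ σ))
  F = Φ₂ pp pq p≢q
  F-eq = Φ₂-eq pp pq p≢q
  Ψ≈ : coeff (Ψ (p * (q * r))) ≈ E (q * r) ⊛ (S p r ⊛ F)
  Ψ≈ = ≈-trans (Ψ-prime³ pp pq pr p≢q p≢r q≢r) (⊛-assoc≈ (E (q * r)) (S p r) F)
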